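{- There is an absolute constant $C$ such that for every positive integer $r$ and every $m$ for which a $\mathrm{DD}(m,r)$ exists, \[ m\leq \tfrac{\sqrt{\pi}}{2}\,r+\tfrac{3\,\pi^{1/3}}{2^{5/3}}\,r^{2/3}+C\,r^{1/3}. \]
   Context: The square grid is $\mathbb{Z}^2\subset\mathbb{R}^2$. A $\mathrm{DD}(m,r)$ (Euclidean square distinct difference configuration) is a set of $m$ points ("dots") of $\mathbb{Z}^2$ such that (1) any two dots are at Euclidean distance at most $r$, and (2) the lines joining pairs of dots are pairwise distinct either in length or in slope; equivalently, the vectors $a-b$, over ordered pairs $(a,b)$ of distinct dots, are pairwise distinct. -}

module Defs where

open import Data.Nat as ℕ using (ℕ; zero; suc)
open import Data.Integer as ℤ using (ℤ; +_)
open import Data.Rational as ℚ using (ℚ)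
open import Data.Fin using (Fin)
open import Data.Product using (_×_; _,_)
open import Function.Definitions using (Injective)
open import Relation.Binary.PropositionalEquality using (_≡_; _≢_)

Point : Set
Point = ℤ × ℤ

diff : Point → Point → Point
diff (x₁ , y₁) (x₂ , y₂) = (x₁ ℤ.- x₂ , y₁ ℤ.- y₂)

dist² : Point → Point → ℤ
dist² a b with diff a b
... | (dx , dy) = dx ℤ.* dx ℤ.+ dy ℤ.* dy

record DD (m r : ℕ) : Set where
  field
    dot      : Fin m → Point
    injDot   : Injective _≡_ _≡_ dot
    close    : ∀ i j → dist² (dot i) (dot j) ℤ.≤ + (r ℕ.* r)
    distinct : ∀ i j k l → i ≢ j → k ≢ l →
               diff (dot i) (dot j) ≡ diff (dot k) (dot l) → (i ≡ k × j ≡ l)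

leibniz : ℕ → ℚ
leibniz zero = ℚ.0ℚ
leibniz (suc n) = leibniz n ℚ.+ term n
  where
  sgn : ℕ → ℤ
  sgn zero = + 4
  sgn (suc zero) = ℤ.- (+ 4)
  sgn (suc (suc k)) = sgn k
  term : ℕ → ℚ
  term k = sgn k ℚ./ suc (2 ℕ.* k)

-- The odd partial sums leibniz (2n+1) are upper bounds of π, strictly
-- decreasing to π.  Hence for rational p:  π < p  iff  ∃ n, leibniz(2n+1) < p.
_>π : ℚ → Set
p >π = Data.Product.∃ λ n → leibniz (suc (2 ℕ.* n)) ℚ.< p
  where import Data.Product

ℕtoℚ : ℕ → ℚ
ℕtoℚ n = + n ℚ./ 1

-- Steiner symmetrisation, done twice on the lattice, maps a finite set of
-- lattice points of diameter D injectively into the quarter disc of radius D.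
-- Translates of a disc of radius R by the dots have diameter r + 2R, so their
-- union has S ≲ π (r + 2R)² / 4 points.  With N ≈ π R² points in the disc, each
-- dot is covered N times; as the differences of dots are distinct, at most
-- m N + N² pairs (dot, translate) share a centre, and Cauchy–Schwarz gives
-- m² N ≤ S (m + N), that is m ≲ √S + S / 2N.  The choice R ≈ r / 2w, with
-- w⁶ ≈ π r² / 4, is optimal and yields √(π r² / 4) + 3 w² / 2 + O(w).
--
-- The role of π r² / 4 is played by the number q of unit squares in the quarter
-- disc of radius r.  Scaling the lattice compares these numbers for different
-- radii, and cutting an octant into K thin sectors turns q into a Riemann sum of
-- 1 / (1 + t²), whose comparison with the Taylor polynomials of the arctangent
-- gives 4 q ≤ r² leibniz (2n + 1) in the limit K → ∞.
module Submission where

open import Defs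
open import Data.Bool using (Bool; true; false)
open import Data.Empty using (⊥-elim)
open import Data.Fin as Fin using (Fin)
import Data.Fin.Properties as Fin
open import Data.Fin.Properties using (injective⇒≤)
open import Data.Integer as ℤ using (ℤ; +_; -[1+_]; ∣_∣; 0ℤ)
import Data.Integer.Properties as ℤ
import Data.Integer.Tactic.RingSolver as ℤ-solver
open import Data.List using (List; []; _∷_; _++_; length; map; filter; lookup; upTo; cartesianProduct; allFin; deduplicate)
open import Data.List.Properties using (length-map; length-++; length-upTo; length-tabulate)
open import Data.List.Membership.Propositional using (_∈_; lose; find)
open import Data.List.Membership.Propositional.Properties
open import Data.List.Relation.Unary.All as All using (All; []; _∷_)
open import Data.List.Relation.Unary.AllPairs using ([]; _∷_)
open import Data.List.Relation.Unary.Any as Any using (here; there; any?)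
open import Data.List.Relation.Unary.Any.Properties using (lookup-index)
open import Data.List.Relation.Unary.Unique.Propositional using (Unique)
import Data.List.Relation.Unary.Unique.Propositional.Properties as Unique
import Data.List.Relation.Unary.Unique.DecPropositional.Properties as UniqueDec
open import Data.Nat as ℕ using (ℕ; zero; suc; z≤n; s≤s; NonZero)
import Data.Nat.Properties as ℕ
open import Data.Nat.Tactic.RingSolver using (solve-∀)
open import Data.Product using (_×_; _,_; proj₁; proj₂; ∃)
open import Data.Product.Properties using (≡-dec)
open import Data.Sum using (_⊎_; inj₁; inj₂)
open import Data.Sum.Properties using (inj₁-injective; inj₂-injective)
open import Function using (_∘_; id)
open import Level using (0ℓ)
open import Relation.Binary.Definitions using (DecidableEquality; tri<; tri≈; tri>)
open import Relation.Binary.PropositionalEquality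
open import Relation.Nullary using (¬_; yes; no; contradiction)
open import Relation.Nullary.Decidable using (_×-dec_; ¬?; dec⇒maybe)
open import Relation.Unary using (Decidable)
import Tactic.RingSolver as RingSolver
open import Tactic.RingSolver.Core.AlmostCommutativeRing using (AlmostCommutativeRing; fromCommutativeRing)

-- The covering inequality needs `S` from above and `N` from below. Both are compared with the same
-- number q, so π enters only once, as an upper bound on q; this suits `_>π`, which speaks of upper
-- bounds only. No limiting density is needed either: divided by the square of the radius, the
-- number of unit squares does not decrease under dilation by an integer and the number of lattice
-- points does not increase, while the two numbers differ only by the points on the axes. Such
-- boundary terms are linear in the radius, so they shift a square root by O(1). The two main terms
-- allow no constant factor to be lost, but errors of order w are free, which is why integer parts
-- of roots and roundings of the radius are harmless.

private variable
  A B : Set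

module Lattice where

  open import Data.Nat using (_+_; _*_; _∸_; _≤_; _<_)
  open import Data.Nat.DivMod using (_/_; _%_; m≡m%n+[m/n]*n; m%n<n; m<n⇒m%n≡m; [m+kn]%n≡m%n; m/n*n≤m; m<n*o⇒m/o<n)

  -- Lattice points of quarter discs

  lookup-injective : {xs : List A} → Unique xs → ∀ i j → lookup xs i ≡ lookup xs j → i ≡ j
  lookup-injective (_ ∷ _)  Fin.zero    Fin.zero    _  = refl
  lookup-injective (x∉ ∷ _) Fin.zero    (Fin.suc j) eq = ⊥-elim (All.lookup x∉ (∈-lookup j) eq)
  lookup-injective (x∉ ∷ _) (Fin.suc i) Fin.zero    eq = ⊥-elim (All.lookup x∉ (∈-lookup i) (sym eq))
  lookup-injective (_ ∷ u)  (Fin.suc i) (Fin.suc j) eq = cong Fin.suc (lookup-injective u i j eq)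

  -- Lists without repetition stand for finite sets throughout, and this is how their sizes are
  -- compared. Injectivity is required only on members, so `f` may be any formula that behaves well
  -- on the set; the positions of the images give an injection between `Fin` types.
  injection⇒length≤ : {xs : List A} {ys : List B} → Unique xs → (f : A → B) →
    (∀ {x y} → x ∈ xs → y ∈ xs → f x ≡ f y → x ≡ y) →
    (∀ {x} → x ∈ xs → f x ∈ ys) → length xs ≤ length ys
  injection⇒length≤ {xs = xs} {ys} u f inj into = injective⇒≤ {f = g} g-inj
    where
    g : Fin (length xs) → Fin (length ys)
    g i = Any.index (into (∈-lookup i))
    g-inj : ∀ {i j} → g i ≡ g j → i ≡ j
    g-inj {i} {j} eq = lookup-injective u i j (inj (∈-lookup i) (∈-lookup j)
      (trans (lookup-index (into (∈-lookup i)))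
        (trans (cong (lookup ys) eq) (sym (lookup-index (into (∈-lookup j)))))))

  length-cartesianProduct : (xs : List A) (ys : List B) →
    length (cartesianProduct xs ys) ≡ length xs * length ys
  length-cartesianProduct []       ys = refl
  length-cartesianProduct (x ∷ xs) ys = trans (length-++ (map (x ,_) ys))
    (cong₂ _+_ (length-map (x ,_) ys) (length-cartesianProduct xs ys))

  module _ {P : A → Set} (P? : Decidable P) where

    length-filter-¬ : (xs : List A) → length xs ≡ length (filter P? xs) + length (filter (¬? ∘ P?) xs)
    length-filter-¬ []       = refl
    length-filter-¬ (x ∷ xs) with P? x
    ... | yes _ = cong suc (length-filter-¬ xs)
    ... | no  _ = trans (cong suc (length-filter-¬ xs)) (sym (ℕ.+-suc _ _))

  ²-cancel-≤ : ∀ {m n} → m * m ≤ n * n → m ≤ n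
  ²-cancel-≤ h = ℕ.≮⇒≥ λ n<m → ℕ.<⇒≱ (ℕ.*-mono-< n<m n<m) h

  ²-cancel-< : ∀ {m n} → m * m < n * n → m < n
  ²-cancel-< h = ℕ.≰⇒> λ n≤m → ℕ.<⇒≱ h (ℕ.*-mono-≤ n≤m n≤m)

  module _ {P : ℕ × ℕ → Set} (P? : Decidable P) (n : ℕ) where

    sublattice : List (ℕ × ℕ)
    sublattice = filter P? (cartesianProduct (upTo n) (upTo n))

    sublattice-unique : Unique sublattice
    sublattice-unique = Unique.filter⁺ P? (Unique.cartesianProduct⁺ (Unique.upTo⁺ n) (Unique.upTo⁺ n))

    ∈-sublattice⁺ : ∀ {i j} → i < n → j < n → P (i , j) → (i , j) ∈ sublattice
    ∈-sublattice⁺ i<n j<n = ∈-filter⁺ P? (∈-cartesianProduct⁺ (∈-upTo⁺ i<n) (∈-upTo⁺ j<n))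

    ∈-sublattice⁻ : ∀ {p} → p ∈ sublattice → P p
    ∈-sublattice⁻ p∈ = proj₂ (∈-filter⁻ P? {xs = cartesianProduct (upTo n) (upTo n)} p∈)

  inQuarter? : ∀ D → Decidable λ ((i , j) : ℕ × ℕ) → i * i + j * j ≤ D * D
  inQuarter? D _ = _ ℕ.≤? _

  cellInQuarter? : ∀ D → Decidable λ ((i , j) : ℕ × ℕ) → suc i * suc i + suc j * suc j ≤ D * D
  cellInQuarter? D _ = _ ℕ.≤? _

  abstract
    quarter : ℕ → List (ℕ × ℕ)
    quarter D = sublattice (inQuarter? D) (suc D)

    -- The lower left corners of the unit squares contained in the quarter disc.
    cells : ℕ → List (ℕ × ℕ)
    cells D = sublattice (cellInQuarter? D) D

    quarter-unique : ∀ D → Unique (quarter D)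
    quarter-unique D = sublattice-unique (inQuarter? D) (suc D)

    cells-unique : ∀ D → Unique (cells D)
    cells-unique D = sublattice-unique (cellInQuarter? D) D

    ∈-quarter⁺ : ∀ {D i j} → i * i + j * j ≤ D * D → (i , j) ∈ quarter D
    ∈-quarter⁺ {D} {i} {j} h = ∈-sublattice⁺ (inQuarter? D) (suc D)
      (s≤s (²-cancel-≤ {i} {D} (ℕ.m+n≤o⇒m≤o (i * i) h)))
      (s≤s (²-cancel-≤ {j} {D} (ℕ.m+n≤o⇒n≤o (i * i) h))) h

    ∈-quarter⁻ : ∀ {D i j} → (i , j) ∈ quarter D → i * i + j * j ≤ D * D
    ∈-quarter⁻ {D} = ∈-sublattice⁻ (inQuarter? D) (suc D)

    ∈-cells⁺ : ∀ {D i j} → suc i * suc i + suc j * suc j ≤ D * D → (i , j) ∈ cells D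
    ∈-cells⁺ {D} {i} {j} h = ∈-sublattice⁺ (cellInQuarter? D) D
      (²-cancel-≤ {suc i} {D} (ℕ.m+n≤o⇒m≤o (suc i * suc i) h))
      (²-cancel-≤ {suc j} {D} (ℕ.m+n≤o⇒n≤o (suc i * suc i) h)) h

    ∈-cells⁻ : ∀ {D i j} → (i , j) ∈ cells D → suc i * suc i + suc j * suc j ≤ D * D
    ∈-cells⁻ {D} = ∈-sublattice⁻ (cellInQuarter? D) D

  #quarter #cells : ℕ → ℕ
  #quarter D = length (quarter D)
  #cells D = length (cells D)

  square : ℕ → List (ℕ × ℕ)
  square n = cartesianProduct (upTo n) (upTo n)

  square-unique : ∀ n → Unique (square n)
  square-unique n = Unique.cartesianProduct⁺ (Unique.upTo⁺ n) (Unique.upTo⁺ n)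

  length-square : ∀ n → length (square n) ≡ n * n
  length-square n = trans (length-cartesianProduct (upTo n) (upTo n)) (cong₂ _*_ (length-upTo n) (length-upTo n))

  ∈-square⁺ : ∀ {n i j} → i < n → j < n → (i , j) ∈ square n
  ∈-square⁺ i<n j<n = ∈-cartesianProduct⁺ (∈-upTo⁺ i<n) (∈-upTo⁺ j<n)

  ∈-square⁻ : ∀ {n i j} → (i , j) ∈ square n → i < n × j < n
  ∈-square⁻ {n} p with ∈-cartesianProduct⁻ (upTo n) (upTo n) p
  ... | i∈ , j∈ = ∈-upTo⁻ i∈ , ∈-upTo⁻ j∈

  digits-injective : ∀ {R a b} i j → a < R → b < R → a + i * R ≡ b + j * R → a ≡ b × i ≡ j
  digits-injective {R@(suc _)} {a} {b} i j a<R b<R eq = a≡b ,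
    ℕ.*-cancelʳ-≡ i j R (ℕ.+-cancelˡ-≡ a _ _ (trans eq (cong (_+ j * R) (sym a≡b))))
    where
    a≡b : a ≡ b
    a≡b = begin
      a               ≡⟨ m<n⇒m%n≡m a<R ⟨
      a % R           ≡⟨ [m+kn]%n≡m%n a i R ⟨
      (a + i * R) % R ≡⟨ cong (_% R) eq ⟩
      (b + j * R) % R ≡⟨ [m+kn]%n≡m%n b j R ⟩
      b % R           ≡⟨ m<n⇒m%n≡m b<R ⟩
      b               ∎
      where open ≡-Reasoning

  square-scale : ∀ D R → D * R * (D * R) ≡ D * D * (R * R)
  square-scale = solve-∀

  -- Dilation by `R` cuts each unit square into `R * R` unit squares that lie in the dilated disc.
  -- The digits to base `R` of a corner recover the original square and the position within it.
  #cells-scale : ∀ D R → R * R * #cells D ≤ #cells (D * R)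
  #cells-scale D R = begin
    R * R * #cells D                                  ≡⟨ ℕ.*-comm (R * R) (#cells D) ⟩
    #cells D * (R * R)                                ≡⟨ cong (#cells D *_) (length-square R) ⟨
    #cells D * length (square R)                      ≡⟨ length-cartesianProduct (cells D) (square R) ⟨
    length (cartesianProduct (cells D) (square R))    ≤⟨ injection⇒length≤
        (Unique.cartesianProduct⁺ (cells-unique D) (square-unique R)) f inj into ⟩
    #cells (D * R)                                    ∎
    where
    open ℕ.≤-Reasoning
    f : (ℕ × ℕ) × (ℕ × ℕ) → ℕ × ℕ
    f ((i , j) , (a , b)) = a + i * R , b + j * R
    inj : ∀ {x y} → x ∈ cartesianProduct (cells D) (square R) → y ∈ cartesianProduct (cells D) (square R) →
          f x ≡ f y → x ≡ y
    inj {(i , j) , _} {(i′ , j′) , _} x∈ y∈ eq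
      with a<R , b<R   ← ∈-square⁻ (proj₂ (∈-cartesianProduct⁻ (cells D) (square R) x∈))
         | a′<R , b′<R ← ∈-square⁻ (proj₂ (∈-cartesianProduct⁻ (cells D) (square R) y∈))
      with refl , refl ← digits-injective i i′ a<R a′<R (cong proj₁ eq)
         | refl , refl ← digits-injective j j′ b<R b′<R (cong proj₂ eq) = refl
    digit : ∀ {a i} → a < R → suc (a + i * R) ≤ suc i * R
    digit {i = i} a<R = ℕ.+-monoˡ-≤ (i * R) a<R
    into : ∀ {x} → x ∈ cartesianProduct (cells D) (square R) → f x ∈ cells (D * R)
    into {(i , j) , (a , b)} x∈
      with ij∈ , ab∈ ← ∈-cartesianProduct⁻ (cells D) (square R) x∈
      with a<R , b<R ← ∈-square⁻ ab∈ = ∈-cells⁺ {D * R} (begin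
        suc (a + i * R) * suc (a + i * R) + suc (b + j * R) * suc (b + j * R)
          ≤⟨ ℕ.+-mono-≤ (ℕ.*-mono-≤ (digit {a} {i} a<R) (digit {a} {i} a<R))
                        (ℕ.*-mono-≤ (digit {b} {j} b<R) (digit {b} {j} b<R)) ⟩
        suc i * R * (suc i * R) + suc j * R * (suc j * R)
          ≡⟨ cong₂ _+_ (square-scale (suc i) R) (square-scale (suc j) R) ⟩
        suc i * suc i * (R * R) + suc j * suc j * (R * R)
          ≡⟨ ℕ.*-distribʳ-+ (R * R) (suc i * suc i) _ ⟨
        (suc i * suc i + suc j * suc j) * (R * R)
          ≤⟨ ℕ.*-monoˡ-≤ (R * R) (∈-cells⁻ ij∈) ⟩
        D * D * (R * R) ≡⟨ square-scale D R ⟨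
        D * R * (D * R) ∎)

  -- The opposite rounding: points are sorted by their residues mod `D`, and within one of the
  -- `D * D` classes the quotients determine the point. Rounding coordinates down only shrinks the
  -- norm, so the quotients stay in the disc of radius `R`.
  #quarter-scale : ∀ D R .{{_ : NonZero D}} → #quarter (D * R) ≤ D * D * #quarter R
  #quarter-scale D R = begin
    #quarter (D * R)                                  ≤⟨ injection⇒length≤ (quarter-unique (D * R)) f inj into ⟩
    length (cartesianProduct (square D) (quarter R))  ≡⟨ length-cartesianProduct (square D) (quarter R) ⟩
    length (square D) * #quarter R                    ≡⟨ cong (_* #quarter R) (length-square D) ⟩
    D * D * #quarter R                                ∎
    where
    open ℕ.≤-Reasoning
    f : ℕ × ℕ → (ℕ × ℕ) × (ℕ × ℕ)
    f (x , y) = (x % D , y % D) , (x / D , y / D)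
    digits-≡ : ∀ {x y} → x % D ≡ y % D → x / D ≡ y / D → x ≡ y
    digits-≡ {x} {y} p q = trans (m≡m%n+[m/n]*n x D)
      (trans (cong₂ (λ a b → a + b * D) p q) (sym (m≡m%n+[m/n]*n y D)))
    inj : ∀ {x y} → x ∈ quarter (D * R) → y ∈ quarter (D * R) → f x ≡ f y → x ≡ y
    inj _ _ eq = cong₂ _,_
      (digits-≡ (cong (proj₁ ∘ proj₁) eq) (cong (proj₁ ∘ proj₂) eq))
      (digits-≡ (cong (proj₂ ∘ proj₁) eq) (cong (proj₂ ∘ proj₂) eq))
    into : ∀ {x} → x ∈ quarter (D * R) → f x ∈ cartesianProduct (square D) (quarter R)
    into {x , y} xy∈ = ∈-cartesianProduct⁺ (∈-square⁺ (m%n<n x D) (m%n<n y D))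
      (∈-quarter⁺ {R} (ℕ.*-cancelˡ-≤ (D * D) {{ℕ.m*n≢0 D D}} (begin
        D * D * (x / D * (x / D) + y / D * (y / D))
          ≡⟨ distrib D (x / D) (y / D) ⟩
        x / D * D * (x / D * D) + y / D * D * (y / D * D)
          ≤⟨ ℕ.+-mono-≤ (ℕ.*-mono-≤ (m/n*n≤m x D) (m/n*n≤m x D)) (ℕ.*-mono-≤ (m/n*n≤m y D) (m/n*n≤m y D)) ⟩
        x * x + y * y      ≤⟨ ∈-quarter⁻ {D * R} xy∈ ⟩
        D * R * (D * R)    ≡⟨ square-scale D R ⟩
        D * D * (R * R)    ∎)))
      where
      distrib : ∀ D a b → D * D * (a * a + b * b) ≡ a * D * (a * D) + b * D * (b * D)
      distrib = solve-∀

  #cells≤#quarter : ∀ D → #cells D ≤ #quarter D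
  #cells≤#quarter D = injection⇒length≤ (cells-unique D) id (λ _ _ → id)
    λ {(i , j)} p → ∈-quarter⁺ {D} (ℕ.≤-trans
      (ℕ.+-mono-≤ (ℕ.*-mono-≤ (ℕ.n≤1+n i) (ℕ.n≤1+n i)) (ℕ.*-mono-≤ (ℕ.n≤1+n j) (ℕ.n≤1+n j)))
      (∈-cells⁻ p))

  -- Both radii are compared at their common multiple `D * R`. Used once to bound the union of
  -- translates from above by q and once to bound the disc of translates from below by q.
  #cells≤#quarter-scaled : ∀ D R .{{_ : NonZero D}} → R * R * #cells D ≤ D * D * #quarter R
  #cells≤#quarter-scaled D R = ℕ.≤-trans (#cells-scale D R)
    (ℕ.≤-trans (#cells≤#quarter (D * R)) (#quarter-scale D R))

  -- A point with two positive coordinates is the upper right corner of a unit square of the disc.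
  -- The others lie on the axes: those on the positive horizontal axis are encoded by the numbers
  -- below `D`, those on the vertical axis, with the origin, by the numbers from `D` on.
  #quarter≤#cells+axes : ∀ D → #quarter D ≤ #cells D + (D + suc D)
  #quarter≤#cells+axes D = begin
    #quarter D      ≤⟨ injection⇒length≤ (quarter-unique D) f inj into ⟩
    length target   ≡⟨ trans (length-++ (map inj₁ (cells D))) (cong₂ _+_ (length-map inj₁ (cells D))
                         (trans (length-map inj₂ (upTo (D + suc D))) (length-upTo (D + suc D)))) ⟩
    #cells D + (D + suc D) ∎
    where
    open ℕ.≤-Reasoning
    target : List ((ℕ × ℕ) ⊎ ℕ)
    target = map inj₁ (cells D) ++ map inj₂ (upTo (D + suc D))
    f : ℕ × ℕ → (ℕ × ℕ) ⊎ ℕ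
    f (suc i , suc j) = inj₁ (i , j)
    f (zero  , j)     = inj₂ (D + j)
    f (suc i , zero)  = inj₂ i
    small : ∀ {i j} → (suc i , j) ∈ quarter D → i < D
    small {i} p = ²-cancel-≤ {suc i} {D} (ℕ.m+n≤o⇒m≤o (suc i * suc i) (∈-quarter⁻ {D} p))
    inj : ∀ {x y} → x ∈ quarter D → y ∈ quarter D → f x ≡ f y → x ≡ y
    inj {suc i , suc j} {suc _ , suc _} _  _  eq with refl ← inj₁-injective eq = refl
    inj {suc _ , zero}  {suc _ , zero}  _  _  eq with refl ← inj₂-injective eq = refl
    inj {zero  , j}     {zero  , k}     _  _  eq = cong (zero ,_) (ℕ.+-cancelˡ-≡ D j k (inj₂-injective eq))
    inj {suc i , zero}  {zero  , k}     x∈ _  eq with refl ← inj₂-injective eq =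
      contradictory (small x∈)
      where
      contradictory : D + k < D → (suc (D + k) , zero) ≡ (zero , k)
      contradictory h with () ← ℕ.m+n≮m D k h
    inj {zero  , k}     {suc i , zero}  _  y∈ eq with refl ← inj₂-injective eq =
      contradictory (small y∈)
      where
      contradictory : D + k < D → (zero , k) ≡ (suc (D + k) , zero)
      contradictory h with () ← ℕ.m+n≮m D k h
    into : ∀ {x} → x ∈ quarter D → f x ∈ target
    into {suc i , suc j} p = ∈-++⁺ˡ (∈-map⁺ inj₁ (∈-cells⁺ {D} (∈-quarter⁻ {D} p)))
    into {suc i , zero}  p = ∈-++⁺ʳ (map inj₁ (cells D)) (∈-map⁺ inj₂ (∈-upTo⁺
      (ℕ.≤-trans (small p) (ℕ.m≤m+n D (suc D)))))
    into {zero , j}      p = ∈-++⁺ʳ (map inj₁ (cells D)) (∈-map⁺ inj₂ (∈-upTo⁺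
      (ℕ.+-monoʳ-< D (s≤s (²-cancel-≤ {j} {D} (∈-quarter⁻ {D} p))))))

  #cells≤² : ∀ D → #cells D ≤ D * D
  #cells≤² D = ℕ.≤-trans (injection⇒length≤ (cells-unique D) id (λ _ _ → id)
      λ {(i , j)} p → ∈-square⁺
        (²-cancel-≤ {suc i} {D} (ℕ.m+n≤o⇒m≤o (suc i * suc i) (∈-cells⁻ p)))
        (²-cancel-≤ {suc j} {D} (ℕ.m+n≤o⇒n≤o (suc i * suc i) (∈-cells⁻ p))))
    (ℕ.≤-reflexive (length-square D))

  -- Side `D / 2` instead of `D / √2` avoids a root; only the order of magnitude matters, to compare
  -- `r` with the square root of q.
  ²≤#cells : ∀ {s D} → s + s ≤ D → s * s ≤ #cells D
  ²≤#cells {s} {D} s+s≤D = ℕ.≤-trans (ℕ.≤-reflexive (sym (length-square s)))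
    (injection⇒length≤ (square-unique s) id (λ _ _ → id) into)
    where
    open ℕ.≤-Reasoning
    into : ∀ {x} → x ∈ square s → x ∈ cells D
    into {i , j} p with i<s , j<s ← ∈-square⁻ {s} p = ∈-cells⁺ {D} (begin
      suc i * suc i + suc j * suc j ≤⟨ ℕ.+-mono-≤ (ℕ.*-mono-≤ i<s i<s) (ℕ.*-mono-≤ j<s j<s) ⟩
      s * s + s * s                 ≤⟨ ℕ.m≤m+n _ (s * s + s * s) ⟩
      s * s + s * s + (s * s + s * s) ≡⟨ expand s ⟩
      (s + s) * (s + s)             ≤⟨ ℕ.*-mono-≤ s+s≤D s+s≤D ⟩
      D * D                         ∎)
      where
      expand : ∀ s → s * s + s * s + (s * s + s * s) ≡ (s + s) * (s + s)
      expand = solve-∀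

  -- The isodiametric inequality

  filter-⊂⇒length< : {P Q : A → Set} (P? : Decidable P) (Q? : Decidable Q) {xs : List A} →
    Unique xs → (∀ {x} → P x → Q x) → ∀ {x} → x ∈ xs → ¬ P x → Q x →
    length (filter P? xs) < length (filter Q? xs)
  filter-⊂⇒length< P? Q? {xs} u P⇒Q {x} x∈ ¬Px Qx = injection⇒length≤
    (All.tabulate (λ { y∈ refl → ¬Px (proj₂ (∈-filter⁻ P? {xs = xs} y∈)) }) ∷ Unique.filter⁺ P? u)
    id (λ _ _ → id)
    λ { (here refl) → ∈-filter⁺ Q? x∈ Qx
      ; (there y∈)  → let y∈xs , Py = ∈-filter⁻ P? {xs = xs} y∈ in ∈-filter⁺ Q? y∈xs (P⇒Q Py) }

  -- Pigeonhole: if all gaps `z - f x` were below `n`, then `n + 1` points would have distinct gaps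
  -- among `n` values.
  far-apart : {xs : List A} (f : A → ℤ) (z : ℤ) → Unique xs →
    (∀ {x y} → x ∈ xs → y ∈ xs → f x ≡ f y → x ≡ y) → (∀ {x} → x ∈ xs → f x ℤ.≤ z) →
    ∀ {n} → length xs ≡ suc n → ∃ λ x → x ∈ xs × + n ℤ.≤ z ℤ.- f x
  far-apart {xs = xs} f z u inj ≤z {n} len with any? (λ x → + n ℤ.≤? z ℤ.- f x) xs
  ... | yes far = find far
  ... | no ¬far = contradiction (begin
      suc n            ≡⟨ len ⟨
      length xs        ≤⟨ injection⇒length≤ u gap (λ x∈ y∈ → inj x∈ y∈ ∘ gap-injective x∈ y∈) into ⟩
      length (upTo n)  ≡⟨ length-upTo n ⟩
      n                ∎) ℕ.1+n≰n
    where
    open ℕ.≤-Reasoning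
    gap = λ x → ∣ z ℤ.- f x ∣
    +gap : ∀ {x} → x ∈ xs → + gap x ≡ z ℤ.- f x
    +gap x∈ = ℤ.0≤i⇒+∣i∣≡i (ℤ.i≤j⇒0≤j-i (≤z x∈))
    gap-injective : ∀ {x y} → x ∈ xs → y ∈ xs → gap x ≡ gap y → f x ≡ f y
    gap-injective {x} {y} x∈ y∈ eq = trans (involutive z (f x)) (trans
      (cong (λ a → z ℤ.- a) (trans (sym (+gap x∈)) (trans (cong +_ eq) (+gap y∈)))) (sym (involutive z (f y))))
      where
      involutive : ∀ z a → a ≡ z ℤ.- (z ℤ.- a)
      involutive = ℤ-solver.solve-∀
    into : ∀ {x} → x ∈ xs → gap x ∈ upTo n
    into x∈ = ∈-upTo⁺ (ℕ.≰⇒> λ n≤gap → ¬far (lose x∈ (subst (+ n ℤ.≤_) (+gap x∈) (ℤ.+≤+ n≤gap))))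

  -- The form shared by both symmetrisations: `S` is the line through `p` (its column, or the points
  -- of its height), `f` the coordinate along that line, and `Q` selects the points before `p`.
  -- Adding `p` itself supplies the extra point for the pigeonhole.
  far-apart-filter : {xs : List A} → Unique xs → {Q : A → Set} (Q? : Decidable Q) (f : A → ℤ) (S : A → Set) →
    ∀ {p} → p ∈ xs → S p → (∀ {q} → Q q → S q × f q ℤ.< f p) →
    (∀ {x y} → x ∈ xs → y ∈ xs → S x → S y → f x ≡ f y → x ≡ y) →
    ∃ λ q → q ∈ xs × S q × + length (filter Q? xs) ℤ.≤ f p ℤ.- f q
  far-apart-filter {xs = xs} u Q? f S {p} p∈ Sp Q⇒ inj =
    let q , q∈ , far = far-apart f (f p) unique (λ x∈ y∈ → inj (inXs x∈) (inXs y∈) (inS x∈) (inS y∈)) ≤p refl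
    in q , inXs q∈ , inS q∈ , far
    where
    candidates = p ∷ filter Q? xs
    inQ : ∀ {q} → q ∈ filter Q? xs → S q × f q ℤ.< f p
    inQ q∈ = Q⇒ (proj₂ (∈-filter⁻ Q? {xs = xs} q∈))
    inXs : ∀ {q} → q ∈ candidates → q ∈ xs
    inXs (here refl) = p∈
    inXs (there q∈)  = proj₁ (∈-filter⁻ Q? q∈)
    inS : ∀ {q} → q ∈ candidates → S q
    inS (here refl) = Sp
    inS (there q∈)  = proj₁ (inQ q∈)
    ≤p : ∀ {q} → q ∈ candidates → f q ℤ.≤ f p
    ≤p (here refl) = ℤ.≤-refl
    ≤p (there q∈)  = ℤ.<⇒≤ (proj₂ (inQ q∈))
    unique : Unique candidates
    unique = All.tabulate (λ { q∈ refl → ℤ.<-irrefl refl (proj₂ (inQ q∈)) }) ∷ Unique.filter⁺ Q? u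

  ²-mono : ∀ {n z} → + n ℤ.≤ z → + (n * n) ℤ.≤ z ℤ.* z
  ²-mono {n} {+ m} (ℤ.+≤+ n≤m) = subst (+ (n * n) ℤ.≤_) (ℤ.pos-* m m) (ℤ.+≤+ (ℕ.*-mono-≤ n≤m n≤m))

  -- Double symmetrisation: a point goes to (number of points below it in its
  -- column, number of points of the same height to the left of it).  Columns with
  -- more than i points and at horizontal distance j have points at vertical
  -- distance at least i, so (i , j) lies in the quarter disc.
  module _ {X : List Point} (unique : Unique X) {D : ℕ}
           (close : ∀ {p q} → p ∈ X → q ∈ X → dist² p q ℤ.≤ + (D * D)) where

    Below Left : Point → Point → Set

    below? : ∀ p → Decidable (Below p)
    left? : ∀ p → Decidable (Left p)

    height width : Point → ℕ
    height p = length (filter (below? p) X)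
    width p = length (filter (left? p) X)

    Below p q = proj₁ q ≡ proj₁ p × proj₂ q ℤ.< proj₂ p
    below? p q = proj₁ q ℤ.≟ proj₁ p ×-dec proj₂ q ℤ.<? proj₂ p

    Left p q = height q ≡ height p × proj₁ q ℤ.< proj₁ p
    left? p q = height q ℕ.≟ height p ×-dec proj₁ q ℤ.<? proj₁ p

    height-mono : ∀ {p q} → p ∈ X → Below q p → height p < height q
    height-mono {p} {q} p∈ (x≡ , y<) = filter-⊂⇒length< (below? p) (below? q) unique
      (λ (e , l) → trans e x≡ , ℤ.<-trans l y<) p∈ (ℤ.<-irrefl refl ∘ proj₂) (x≡ , y<)

    width-mono : ∀ {p q} → p ∈ X → Left q p → width p < width q
    width-mono {p} {q} p∈ (h≡ , x<) = filter-⊂⇒length< (left? p) (left? q) unique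
      (λ (e , l) → trans e h≡ , ℤ.<-trans l x<) p∈ (ℤ.<-irrefl refl ∘ proj₂) (h≡ , x<)

    height-injective : ∀ {p q} → p ∈ X → q ∈ X → proj₁ p ≡ proj₁ q → height p ≡ height q → p ≡ q
    height-injective {p} {q} p∈ q∈ x≡ h≡ with ℤ.<-cmp (proj₂ p) (proj₂ q)
    ... | tri< y< _ _ = contradiction h≡ (ℕ.<⇒≢ (height-mono p∈ (x≡ , y<)))
    ... | tri≈ _ y≡ _ = cong₂ _,_ x≡ y≡
    ... | tri> _ _ y> = contradiction (sym h≡) (ℕ.<⇒≢ (height-mono q∈ (sym x≡ , y>)))

    symmetrise-injective : ∀ {p q} → p ∈ X → q ∈ X → (height p , width p) ≡ (height q , width q) → p ≡ q
    symmetrise-injective {p} {q} p∈ q∈ eq with ℤ.<-cmp (proj₁ p) (proj₁ q)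
    ... | tri< x< _ _ = contradiction (cong proj₂ eq) (ℕ.<⇒≢ (width-mono p∈ (cong proj₁ eq , x<)))
    ... | tri≈ _ x≡ _ = height-injective p∈ q∈ x≡ (cong proj₁ eq)
    ... | tri> _ _ x> = contradiction (sym (cong proj₂ eq)) (ℕ.<⇒≢ (width-mono q∈ (sym (cong proj₁ eq) , x>)))

    lowest : ∀ {p} → p ∈ X → ∃ λ q → q ∈ X × proj₁ q ≡ proj₁ p × + height p ℤ.≤ proj₂ p ℤ.- proj₂ q
    lowest {p} p∈ = far-apart-filter unique (below? p) proj₂ (λ q → proj₁ q ≡ proj₁ p) p∈ refl id
      (λ _ _ x≡ x≡′ y≡ → cong₂ _,_ (trans x≡ (sym x≡′)) y≡)

    leftmost : ∀ {p} → p ∈ X → ∃ λ q → q ∈ X × height q ≡ height p × + width p ℤ.≤ proj₁ p ℤ.- proj₁ q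
    leftmost {p} p∈ = far-apart-filter unique (left? p) proj₁ (λ q → height q ≡ height p) p∈ refl id
      (λ q∈ q′∈ h≡ h≡′ x≡ → height-injective q∈ q′∈ x≡ (trans h≡ (sym h≡′)))

    far-points : ∀ {i j p q} → p ∈ X → q ∈ X → + j ℤ.≤ proj₁ p ℤ.- proj₁ q →
      + (i * i) ℤ.≤ (proj₂ p ℤ.- proj₂ q) ℤ.* (proj₂ p ℤ.- proj₂ q) → i * i + j * j ≤ D * D
    far-points {i} {j} {p} {q} p∈ q∈ hj hi = ℤ.drop‿+≤+ (begin
      + (i * i + j * j)         ≡⟨ cong +_ (ℕ.+-comm (i * i) (j * j)) ⟩
      + (j * j) ℤ.+ + (i * i)   ≤⟨ ℤ.+-mono-≤ (²-mono hj) hi ⟩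
      dist² p q                 ≤⟨ close p∈ q∈ ⟩
      + (D * D)                 ∎)
      where open ℤ.≤-Reasoning

    -- The diagonals from `q↓` to `p` and from `p↓` to `q` have rises whose sum is the sum of the
    -- extents of the two columns, at least twice `height p`. Hence one of them rises by at least
    -- `height p`, and its ends are at least `width p` apart horizontally.
    symmetrise-∈ : ∀ {p} → p ∈ X → (height p , width p) ∈ quarter D
    symmetrise-∈ {p} p∈
      with q , q∈ , hq , wide ← leftmost p∈
      with p↓ , p↓∈ , x≡p , tall-p ← lowest p∈ | q↓ , q↓∈ , x≡q , tall-q ← lowest q∈
      with + height p ℤ.≤? proj₂ p ℤ.- proj₂ q↓
    ... | yes tall = ∈-quarter⁺ {D} (far-points {height p} {width p} p∈ q↓∈
            (subst (λ x → + width p ℤ.≤ proj₁ p ℤ.- x) (sym x≡q) wide) (²-mono tall))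
    ... | no ¬tall = ∈-quarter⁺ {D} (far-points {height p} {width p} p↓∈ q∈
            (subst (λ x → + width p ℤ.≤ x ℤ.- proj₁ q) (sym x≡p) wide)
            (subst (+ (height p * height p) ℤ.≤_) (flip² (proj₂ q) (proj₂ p↓)) (²-mono tall)))
      where
      flip² : ∀ a b → (a ℤ.- b) ℤ.* (a ℤ.- b) ≡ (b ℤ.- a) ℤ.* (b ℤ.- a)
      flip² = ℤ-solver.solve-∀
      cross : ∀ a b c d → (a ℤ.- b ℤ.+ (c ℤ.- d)) ≡ c ℤ.- b ℤ.+ (a ℤ.- d)
      cross = ℤ-solver.solve-∀
      tall : + height p ℤ.≤ proj₂ q ℤ.- proj₂ p↓
      tall = ℤ.≮⇒≥ λ short → ℤ.<⇒≱ (ℤ.+-mono-< short (ℤ.≰⇒> ¬tall)) (begin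
        + height p ℤ.+ + height p  ≤⟨ ℤ.+-mono-≤ tall-p (subst (λ h → + h ℤ.≤ _) hq tall-q) ⟩
        proj₂ p ℤ.- proj₂ p↓ ℤ.+ (proj₂ q ℤ.- proj₂ q↓)
          ≡⟨ cross (proj₂ p) (proj₂ p↓) (proj₂ q) (proj₂ q↓) ⟩
        proj₂ q ℤ.- proj₂ p↓ ℤ.+ (proj₂ p ℤ.- proj₂ q↓) ∎)
        where open ℤ.≤-Reasoning

    isodiametric : length X ≤ #quarter D
    isodiametric = injection⇒length≤ unique (λ p → height p , width p) symmetrise-injective symmetrise-∈

  -- Counting coincidences

  am-gm : ∀ a b → 4 * (a * b) ≤ (a + b) * (a + b)
  am-gm a b with ℕ.≤-total a b
  ... | inj₁ a≤b with d , refl ← ℕ.m≤n⇒∃[o]m+o≡n a≤b = ℕ.≤-trans (ℕ.m≤m+n _ (d * d)) (ℕ.≤-reflexive (eq a d))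
    where
    eq : ∀ a d → 4 * (a * (a + d)) + d * d ≡ (a + (a + d)) * (a + (a + d))
    eq = solve-∀
  ... | inj₂ b≤a with d , refl ← ℕ.m≤n⇒∃[o]m+o≡n b≤a = ℕ.≤-trans (ℕ.m≤m+n _ (d * d)) (ℕ.≤-reflexive (eq b d))
    where
    eq : ∀ a d → 4 * ((a + d) * a) + d * d ≡ (a + d + a) * (a + d + a)
    eq = solve-∀

  -- Induction step of Cauchy-Schwarz when a class of size `k` joins `s` classes. To avoid dividing
  -- by `s`, the mixed term `2 * (k * n)` is bounded through its square, where `am-gm` applies to
  -- `w` and `s * (k * k)`.
  cauchy-step : ∀ {s w} k n → n * n ≤ s * w → (k + n) * (k + n) ≤ suc s * (k * k + w)
  cauchy-step {s} {w} k n n²≤ = begin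
    (k + n) * (k + n)                ≡⟨ expand k n ⟩
    k * k + n * n + 2 * (k * n)      ≤⟨ ℕ.+-mono-≤ (ℕ.+-monoʳ-≤ (k * k) n²≤) mixed ⟩
    k * k + s * w + (w + s * (k * k)) ≡⟨ collect s (k * k) w ⟩
    suc s * (k * k + w)              ∎
    where
    open ℕ.≤-Reasoning
    expand : ∀ k n → (k + n) * (k + n) ≡ k * k + n * n + 2 * (k * n)
    expand = solve-∀
    collect : ∀ s a w → a + s * w + (w + s * a) ≡ suc s * (a + w)
    collect = solve-∀
    left : ∀ k n → 2 * (k * n) * (2 * (k * n)) ≡ 4 * (k * k * (n * n))
    left = solve-∀
    right : ∀ s a w → 4 * (a * (s * w)) ≡ 4 * (w * (s * a))
    right = solve-∀
    mixed : 2 * (k * n) ≤ w + s * (k * k)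
    mixed = ²-cancel-≤ (begin
      2 * (k * n) * (2 * (k * n))   ≡⟨ left k n ⟩
      4 * (k * k * (n * n))         ≤⟨ ℕ.*-monoʳ-≤ 4 (ℕ.*-monoʳ-≤ (k * k) n²≤) ⟩
      4 * (k * k * (s * w))         ≡⟨ right s (k * k) w ⟩
      4 * (w * (s * (k * k)))       ≤⟨ am-gm w (s * (k * k)) ⟩
      (w + s * (k * k)) * (w + s * (k * k)) ∎)

  module Collisions {A C : Set} (_≟_ : DecidableEquality C) (f : A → C) where

    collide? : Decidable λ ((a , b) : A × A) → f a ≡ f b
    collide? (a , b) = f a ≟ f b

    abstract
      collisions : List A → List (A × A)
      collisions xs = filter collide? (cartesianProduct xs xs)

      ∈-collisions⁺ : ∀ {xs a b} → a ∈ xs → b ∈ xs → f a ≡ f b → (a , b) ∈ collisions xs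
      ∈-collisions⁺ a∈ b∈ = ∈-filter⁺ collide? (∈-cartesianProduct⁺ a∈ b∈)

      ∈-collisions⁻ : ∀ {xs a b} → (a , b) ∈ collisions xs → (a ∈ xs × b ∈ xs) × f a ≡ f b
      ∈-collisions⁻ {xs} p = let p∈ , eq = ∈-filter⁻ collide? {xs = cartesianProduct xs xs} p
                             in ∈-cartesianProduct⁻ xs xs p∈ , eq

      collisions-unique : ∀ {xs} → Unique xs → Unique (collisions xs)
      collisions-unique u = Unique.filter⁺ collide? (Unique.cartesianProduct⁺ u u)

    fibre co-fibre : C → List A → List A
    fibre c = filter (λ a → f a ≟ c)
    co-fibre c = filter (λ a → ¬? (f a ≟ c))

    length-collisions : ∀ {xs} → Unique xs → ∀ c →
      length (fibre c xs) * length (fibre c xs) + length (collisions (co-fibre c xs)) ≤ length (collisions xs)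
    length-collisions {xs} u c = begin
      length F * length F + length (collisions F′)
        ≡⟨ trans (length-++ (cartesianProduct F F)) (cong (_+ length (collisions F′)) (length-cartesianProduct F F)) ⟨
      length (cartesianProduct F F ++ collisions F′)
        ≤⟨ injection⇒length≤ (Unique.++⁺ (Unique.cartesianProduct⁺ F! F!) (collisions-unique (Unique.filter⁺ _ u)) disjoint)
             id (λ _ _ → id) into ⟩
      length (collisions xs) ∎
      where
      open ℕ.≤-Reasoning
      F = fibre c xs
      F′ = co-fibre c xs
      F! : Unique F
      F! = Unique.filter⁺ _ u
      fibre⁻ : ∀ {a} → a ∈ F → a ∈ xs × f a ≡ c
      fibre⁻ = ∈-filter⁻ (λ a → f a ≟ c) {xs = xs}
      co-fibre⁻ : ∀ {a} → a ∈ F′ → a ∈ xs × f a ≢ c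
      co-fibre⁻ = ∈-filter⁻ (λ a → ¬? (f a ≟ c)) {xs = xs}
      disjoint : ∀ {p} → ¬ (p ∈ cartesianProduct F F × p ∈ collisions F′)
      disjoint (p , p′) = proj₂ (co-fibre⁻ (proj₁ (proj₁ (∈-collisions⁻ p′))))
                                (proj₂ (fibre⁻ (proj₁ (∈-cartesianProduct⁻ F F p))))
      into : ∀ {p} → p ∈ cartesianProduct F F ++ collisions F′ → p ∈ collisions xs
      into {a , b} p∈ with ∈-++⁻ (cartesianProduct F F) p∈
      ... | inj₁ ab∈ with a∈ , b∈ ← ∈-cartesianProduct⁻ F F ab∈
                     with a∈xs , fa ← fibre⁻ a∈ | b∈xs , fb ← fibre⁻ b∈ =
              ∈-collisions⁺ a∈xs b∈xs (trans fa (sym fb))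
      ... | inj₂ ab∈ with (a∈ , b∈) , eq ← ∈-collisions⁻ ab∈ =
              ∈-collisions⁺ (proj₁ (co-fibre⁻ a∈)) (proj₁ (co-fibre⁻ b∈)) eq

    -- Peels off the fibre of one value at a time. The list `cs` only has to cover the values, so
    -- fibres may be empty.
    length²≤collisions : ∀ cs {xs} → Unique xs → (∀ {a} → a ∈ xs → f a ∈ cs) →
      length xs * length xs ≤ length cs * length (collisions xs)
    length²≤collisions []       {[]}    _ _    = z≤n
    length²≤collisions []       {x ∷ _} _ into with () ← into (here refl)
    length²≤collisions (c ∷ cs) {xs}    u into = begin
      length xs * length xs
        ≡⟨ cong (λ n → n * n) (length-filter-¬ (λ a → f a ≟ c) xs) ⟩
      (length (fibre c xs) + length (co-fibre c xs)) * (length (fibre c xs) + length (co-fibre c xs))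
        ≤⟨ cauchy-step {length cs} (length (fibre c xs)) (length (co-fibre c xs))
             (length²≤collisions cs (Unique.filter⁺ _ u) into′) ⟩
      suc (length cs) * (length (fibre c xs) * length (fibre c xs) + length (collisions (co-fibre c xs)))
        ≤⟨ ℕ.*-monoʳ-≤ (suc (length cs)) (length-collisions u c) ⟩
      suc (length cs) * length (collisions xs) ∎
      where
      open ℕ.≤-Reasoning
      into′ : ∀ {a} → a ∈ co-fibre c xs → f a ∈ cs
      into′ a∈ with a∈xs , fa≢c ← ∈-filter⁻ (λ a → ¬? (f a ≟ c)) {xs = xs} a∈ with into a∈xs
      ... | here fa≡c = contradiction fa≡c fa≢c
      ... | there fa∈ = fa∈

  -- Translates of a disc by the dots

  norm² : Point → ℤ
  norm² (x , y) = x ℤ.* x ℤ.+ y ℤ.* y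

  signed : Bool → ℕ → ℤ
  signed true  n = + suc n
  signed false n = -[1+ n ]

  signed-injective : ∀ {s t m n} → signed s m ≡ signed t n → s ≡ t × m ≡ n
  signed-injective {true}  {true}  refl = refl , refl
  signed-injective {false} {false} refl = refl , refl

  signed-² : ∀ s n → signed s n ℤ.* signed s n ≡ + (suc n * suc n)
  signed-² true  n = refl
  signed-² false n = refl

  signs : List (Bool × Bool)
  signs = cartesianProduct (true ∷ false ∷ []) (true ∷ false ∷ [])

  reflect : (Bool × Bool) × (ℕ × ℕ) → Point
  reflect ((s , t) , (i , j)) = signed s i , signed t j

  -- The square `(i , j)` yields the four points with coordinates ±(i + 1) and ±(j + 1). Leaving out
  -- the axes makes the size exactly `4 * #cells R`, at the price of O(R) points of the disc.
  offAxisDisc : ℕ → List Point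
  offAxisDisc R = map reflect (cartesianProduct signs (cells R))

  length-offAxisDisc : ∀ R → length (offAxisDisc R) ≡ 4 * #cells R
  length-offAxisDisc R = trans (length-map reflect (cartesianProduct signs (cells R)))
    (length-cartesianProduct signs (cells R))

  offAxisDisc-unique : ∀ R → Unique (offAxisDisc R)
  offAxisDisc-unique R = Unique.map⁺ inj
    (Unique.cartesianProduct⁺ (Unique.cartesianProduct⁺ bools bools) (cells-unique R))
    where
    bools : Unique (true ∷ false ∷ [])
    bools = ((λ ()) ∷ []) ∷ [] ∷ []
    inj : ∀ {x y} → reflect x ≡ reflect y → x ≡ y
    inj eq with refl , refl ← signed-injective (cong proj₁ eq) | refl , refl ← signed-injective (cong proj₂ eq) = refl

  offAxisDisc-norm² : ∀ {R β} → β ∈ offAxisDisc R → norm² β ℤ.≤ + (R * R)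
  offAxisDisc-norm² {R} β∈ with ((s , t) , (i , j)) , x∈ , refl ← ∈-map⁻ reflect β∈ =
    subst (ℤ._≤ + (R * R)) (sym (cong₂ ℤ._+_ (signed-² s i) (signed-² t j)))
      (ℤ.+≤+ (∈-cells⁻ (proj₂ (∈-cartesianProduct⁻ signs (cells R) x∈))))

  _⊕_ : Point → Point → Point
  (a , b) ⊕ (c , d) = a ℤ.+ c , b ℤ.+ d

  0≤i² : ∀ i → 0ℤ ℤ.≤ i ℤ.* i
  0≤i² (+ n)    = subst (0ℤ ℤ.≤_) (ℤ.pos-* n n) (ℤ.+≤+ z≤n)
  0≤i² -[1+ n ] = ℤ.+≤+ z≤n

  *-mono-≤-+ : ∀ {i j m n} → 0ℤ ℤ.≤ i → 0ℤ ℤ.≤ j → i ℤ.≤ + m → j ℤ.≤ + n → i ℤ.* j ℤ.≤ + (m * n)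
  *-mono-≤-+ {+ i} {+ j} _ _ (ℤ.+≤+ i≤m) (ℤ.+≤+ j≤n) =
    subst (ℤ._≤ _) (ℤ.pos-* i j) (ℤ.+≤+ (ℕ.*-mono-≤ i≤m j≤n))

  -- Expanding the square leaves twice the inner product, which Lagrange's identity bounds by
  -- `s * t`. Squared norms keep the argument inside ℤ.
  norm²-triangle : ∀ u v {s t} → norm² u ℤ.≤ + (s * s) → norm² v ℤ.≤ + (t * t) →
    norm² (u ⊕ v) ℤ.≤ + ((s + t) * (s + t))
  norm²-triangle u@(a , b) v@(c , d) {s} {t} hu hv = begin
    norm² (u ⊕ v)                                              ≡⟨ expand a b c d ⟩
    norm² u ℤ.+ norm² v ℤ.+ (inner ℤ.+ inner)                  ≤⟨ ℤ.+-mono-≤ (ℤ.+-mono-≤ hu hv) (ℤ.+-mono-≤ inner≤ inner≤) ⟩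
    + (s * s + t * t + (s * t + s * t))                        ≡⟨ cong +_ (binomial s t) ⟩
    + ((s + t) * (s + t))                                      ∎
    where
    open ℤ.≤-Reasoning
    inner = a ℤ.* c ℤ.+ b ℤ.* d
    expand : ∀ a b c d → (a ℤ.+ c) ℤ.* (a ℤ.+ c) ℤ.+ (b ℤ.+ d) ℤ.* (b ℤ.+ d) ≡
      a ℤ.* a ℤ.+ b ℤ.* b ℤ.+ (c ℤ.* c ℤ.+ d ℤ.* d) ℤ.+ (a ℤ.* c ℤ.+ b ℤ.* d ℤ.+ (a ℤ.* c ℤ.+ b ℤ.* d))
    expand = ℤ-solver.solve-∀
    binomial : ∀ s t → s * s + t * t + (s * t + s * t) ≡ (s + t) * (s + t)
    binomial = solve-∀
    lagrange : ∀ a b c d → (a ℤ.* c ℤ.+ b ℤ.* d) ℤ.* (a ℤ.* c ℤ.+ b ℤ.* d) ℤ.+ (a ℤ.* d ℤ.- b ℤ.* c) ℤ.* (a ℤ.* d ℤ.- b ℤ.* c)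
      ≡ (a ℤ.* a ℤ.+ b ℤ.* b) ℤ.* (c ℤ.* c ℤ.+ d ℤ.* d)
    lagrange = ℤ-solver.solve-∀
    rearrange : ∀ s t → s * s * (t * t) ≡ s * t * (s * t)
    rearrange = solve-∀
    0≤norm² : ∀ u → 0ℤ ℤ.≤ norm² u
    0≤norm² (x , y) = ℤ.+-mono-≤ (0≤i² x) (0≤i² y)
    inner² : inner ℤ.* inner ℤ.≤ + (s * t * (s * t))
    inner² = begin
      inner ℤ.* inner        ≡⟨ ℤ.+-identityʳ _ ⟨
      inner ℤ.* inner ℤ.+ 0ℤ ≤⟨ ℤ.+-monoʳ-≤ (inner ℤ.* inner) (0≤i² (a ℤ.* d ℤ.- b ℤ.* c)) ⟩
      inner ℤ.* inner ℤ.+ (a ℤ.* d ℤ.- b ℤ.* c) ℤ.* (a ℤ.* d ℤ.- b ℤ.* c) ≡⟨ lagrange a b c d ⟩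
      norm² u ℤ.* norm² v    ≤⟨ *-mono-≤-+ (0≤norm² u) (0≤norm² v) hu hv ⟩
      + (s * s * (t * t))    ≡⟨ cong +_ (rearrange s t) ⟩
      + (s * t * (s * t))    ∎
    bound : ∀ i {n} → i ℤ.* i ℤ.≤ + (n * n) → i ℤ.≤ + n
    bound (+ m) h = ℤ.+≤+ (²-cancel-≤ (ℤ.drop‿+≤+ (subst (ℤ._≤ _) (sym (ℤ.pos-* m m)) h)))
    bound -[1+ _ ] _ = ℤ.-≤+
    inner≤ : inner ℤ.≤ + (s * t)
    inner≤ = bound inner inner²

  module Covering {m r : ℕ} (dd : DD m r) (R : ℕ) where
    open DD dd

    disc : List Point
    disc = offAxisDisc R

    N : ℕ
    N = length disc

    pairs : List (Fin m × Point)
    pairs = cartesianProduct (allFin m) disc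

    centre : Fin m × Point → Point
    centre (i , β) = dot i ⊕ β

    _≟ₚ_ : DecidableEquality Point
    _≟ₚ_ = ≡-dec ℤ._≟_ ℤ._≟_

    open Collisions _≟ₚ_ centre

    pairs-unique : Unique pairs
    pairs-unique = Unique.cartesianProduct⁺ (Unique.allFin⁺ m) (offAxisDisc-unique R)

    length-pairs : length pairs ≡ m * N
    length-pairs = trans (length-cartesianProduct (allFin m) disc) (cong (_* N) (length-tabulate {n = m} id))

    -- The translates overlap, while `isodiametric` is about lists without repetition; hence
    -- `deduplicate`. The overlaps are what `collisions` measures.
    centres : List Point
    centres = deduplicate _≟ₚ_ (map centre pairs)

    ∈-centres⁻ : ∀ {p} → p ∈ centres → ∃ λ i → ∃ λ β → β ∈ disc × p ≡ dot i ⊕ β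
    ∈-centres⁻ p∈ with (i , β) , iβ∈ , eq ← ∈-map⁻ centre (∈-deduplicate⁻ _≟ₚ_ (map centre pairs) p∈) =
      i , β , proj₂ (∈-cartesianProduct⁻ (allFin m) disc iβ∈) , eq

    centres-close : ∀ {p q} → p ∈ centres → q ∈ centres → dist² p q ℤ.≤ + ((r + (R + R)) * (r + (R + R)))
    centres-close p∈ q∈
      with i , β@(b₁ , b₂) , β∈ , refl ← ∈-centres⁻ p∈ | j , γ@(c₁ , c₂) , γ∈ , refl ← ∈-centres⁻ q∈ =
      subst (ℤ._≤ _) (sym (split (proj₁ (dot i)) (proj₂ (dot i)) b₁ b₂ (proj₁ (dot j)) (proj₂ (dot j)) c₁ c₂))
        (norm²-triangle (diff (dot i) (dot j)) (β ⊕ (ℤ.- c₁ , ℤ.- c₂)) {r} {R + R} (close i j)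
          (norm²-triangle β (ℤ.- c₁ , ℤ.- c₂) {R} {R} (offAxisDisc-norm² β∈)
            (subst (ℤ._≤ _) (neg² c₁ c₂) (offAxisDisc-norm² γ∈))))
      where
      neg² : ∀ c d → c ℤ.* c ℤ.+ d ℤ.* d ≡ ℤ.- c ℤ.* ℤ.- c ℤ.+ ℤ.- d ℤ.* ℤ.- d
      neg² = ℤ-solver.solve-∀
      shift : ∀ x b y c → x ℤ.+ b ℤ.- (y ℤ.+ c) ≡ x ℤ.- y ℤ.+ (b ℤ.+ ℤ.- c)
      shift = ℤ-solver.solve-∀
      split : ∀ x₁ x₂ b₁ b₂ y₁ y₂ c₁ c₂ → norm² (x₁ ℤ.+ b₁ ℤ.- (y₁ ℤ.+ c₁) , x₂ ℤ.+ b₂ ℤ.- (y₂ ℤ.+ c₂)) ≡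
        norm² (x₁ ℤ.- y₁ ℤ.+ (b₁ ℤ.+ ℤ.- c₁) , x₂ ℤ.- y₂ ℤ.+ (b₂ ℤ.+ ℤ.- c₂))
      split x₁ x₂ b₁ b₂ y₁ y₂ c₁ c₂ = cong₂ (λ x y → norm² (x , y)) (shift x₁ b₁ y₁ c₁) (shift x₂ b₂ y₂ c₂)

    ⊕-cancelˡ : ∀ u {v w} → u ⊕ v ≡ u ⊕ w → v ≡ w
    ⊕-cancelˡ (a , b) {v₁ , v₂} {w₁ , w₂} eq = cong₂ _,_ (cancel a v₁ w₁ (cong proj₁ eq)) (cancel b v₂ w₂ (cong proj₂ eq))
      where
      undo : ∀ a v → v ≡ a ℤ.+ v ℤ.- a
      undo = ℤ-solver.solve-∀
      cancel : ∀ a v w → a ℤ.+ v ≡ a ℤ.+ w → v ≡ w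
      cancel a v w h = trans (undo a v) (trans (cong (ℤ._- a) h) (sym (undo a w)))

    ⊕-diff : ∀ u v {β γ} → u ⊕ β ≡ v ⊕ γ → diff u v ≡ diff γ β
    ⊕-diff (a , b) (c , d) {β₁ , β₂} {γ₁ , γ₂} eq =
      cong₂ _,_ (move a c β₁ γ₁ (cong proj₁ eq)) (move b d β₂ γ₂ (cong proj₂ eq))
      where
      before : ∀ a c β → a ℤ.- c ≡ a ℤ.+ β ℤ.- c ℤ.- β
      before = ℤ-solver.solve-∀
      after : ∀ c β γ → c ℤ.+ γ ℤ.- c ℤ.- β ≡ γ ℤ.- β
      after = ℤ-solver.solve-∀
      move : ∀ a c β γ → a ℤ.+ β ≡ c ℤ.+ γ → a ℤ.- c ≡ γ ℤ.- β
      move a c β γ h = trans (before a c β) (trans (cong (λ x → x ℤ.- c ℤ.- β) h) (after c β γ))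

    -- A collision dot i + β = dot j + γ with i ≠ j is determined by (β , γ).
    length-collisions≤ : length (collisions pairs) ≤ m * N + N * N
    length-collisions≤ = begin
      length (collisions pairs) ≤⟨ injection⇒length≤ (collisions-unique pairs-unique) g inj into ⟩
      length target             ≡⟨ trans (length-++ (map inj₁ pairs)) (cong₂ _+_
                                     (trans (length-map inj₁ pairs) length-pairs)
                                     (trans (length-map inj₂ (cartesianProduct disc disc)) (length-cartesianProduct disc disc))) ⟩
      m * N + N * N             ∎
      where
      open ℕ.≤-Reasoning
      target : List ((Fin m × Point) ⊎ (Point × Point))
      target = map inj₁ pairs ++ map inj₂ (cartesianProduct disc disc)
      g : (Fin m × Point) × (Fin m × Point) → (Fin m × Point) ⊎ (Point × Point)
      g ((i , β) , (j , γ)) with i Fin.≟ j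
      ... | yes _ = inj₁ (i , β)
      ... | no  _ = inj₂ (β , γ)
      inj : ∀ {x y} → x ∈ collisions pairs → y ∈ collisions pairs → g x ≡ g y → x ≡ y
      inj {(i , β) , (j , γ)} {(k , β′) , (l , γ′)} x∈ y∈ eq
        with eq₁ ← proj₂ (∈-collisions⁻ x∈) | eq₂ ← proj₂ (∈-collisions⁻ y∈)
        with i Fin.≟ j | k Fin.≟ l
      -- Over one and the same dot the two offsets agree, so the first component alone recovers the
      -- collision.
      ... | yes refl | yes refl with refl ← inj₁-injective eq
                                with refl ← ⊕-cancelˡ (dot i) eq₁ | refl ← ⊕-cancelˡ (dot i) eq₂ = refl
      ... | no i≢j   | no k≢l   with refl ← inj₂-injective eq
                                with refl , refl ← distinct i j k l i≢j k≢l
                                       (trans (⊕-diff (dot i) (dot j) eq₁) (sym (⊕-diff (dot k) (dot l) eq₂))) = refl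
      into : ∀ {x} → x ∈ collisions pairs → g x ∈ target
      into {(i , β) , (j , γ)} x∈ with (iβ∈ , jγ∈) , _ ← ∈-collisions⁻ x∈ with i Fin.≟ j
      ... | yes _ = ∈-++⁺ˡ (∈-map⁺ inj₁ iβ∈)
      ... | no  _ = ∈-++⁺ʳ (map inj₁ pairs) (∈-map⁺ inj₂ (∈-cartesianProduct⁺
                      (proj₂ (∈-cartesianProduct⁻ (allFin m) disc iβ∈))
                      (proj₂ (∈-cartesianProduct⁻ (allFin m) disc jγ∈))))

    covering-bound : m * N * (m * N) ≤ #quarter (r + (R + R)) * (m * N + N * N)
    covering-bound = begin
      m * N * (m * N)               ≡⟨ cong (λ n → n * n) length-pairs ⟨
      length pairs * length pairs   ≤⟨ length²≤collisions centres pairs-unique (λ a∈ → ∈-deduplicate⁺ _≟ₚ_ (∈-map⁺ centre a∈)) ⟩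
      length centres * length (collisions pairs)
        ≤⟨ ℕ.*-mono-≤ (isodiametric (UniqueDec.deduplicate-! _≟ₚ_ (map centre pairs)) centres-close) length-collisions≤ ⟩
      #quarter (r + (R + R)) * (m * N + N * N) ∎
      where open ℕ.≤-Reasoning

  -- Of order r², hence too weak in general; it serves the bounded range of `r` in which the
  -- covering argument is not run.
  dots≤#quarter : ∀ {m r} → DD m r → m ≤ #quarter r
  dots≤#quarter {m} {r} dd = begin
    m                         ≡⟨ trans (length-map dot (allFin m)) (length-tabulate id) ⟨
    length (map dot (allFin m)) ≤⟨ isodiametric (Unique.map⁺ injDot (Unique.allFin⁺ m)) close′ ⟩
    #quarter r                ∎
    where
    open ℕ.≤-Reasoning
    open DD dd
    close′ : ∀ {p q} → p ∈ map dot (allFin m) → q ∈ map dot (allFin m) → dist² p q ℤ.≤ + (r * r)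
    close′ p∈ q∈ with i , _ , refl ← ∈-map⁻ dot p∈ | j , _ , refl ← ∈-map⁻ dot q∈ = close i j

  -- Sectors of an octant

  greatest : {P : ℕ → Set} (P? : Decidable P) → P 0 → ∀ n → ¬ P n → ∃ λ w → P w × ¬ P (suc w)
  greatest P? P0 zero    ¬P0 = contradiction P0 ¬P0
  greatest P? P0 (suc n) ¬Pn with P? n
  ... | yes Pn = n , Pn , ¬Pn
  ... | no ¬Pn′ = greatest P? P0 n ¬Pn′

  sumTo : ℕ → (ℕ → ℕ) → ℕ
  sumTo zero    f = 0
  sumTo (suc n) f = sumTo n f + f n

  sumTo-mono : ∀ n {f g} → (∀ {k} → k < n → f k ≤ g k) → sumTo n f ≤ sumTo n g
  sumTo-mono zero    f≤g = z≤n
  sumTo-mono (suc n) f≤g = ℕ.+-mono-≤ (sumTo-mono n (λ k<n → f≤g (ℕ.m<n⇒m<1+n k<n))) (f≤g (ℕ.n<1+n n))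

  fibre-count : (g : A → ℕ) → ∀ n {xs} → Unique xs → (∀ {x} → x ∈ xs → g x < n) →
    length xs ≤ sumTo n (λ k → length (filter (λ x → g x ℕ.≟ k) xs))
  fibre-count g zero    {[]}    _ _   = z≤n
  fibre-count g zero    {_ ∷ _} _ g<0 with () ← g<0 (here refl)
  fibre-count g (suc n) {xs}    u g<n = begin
    length xs                            ≡⟨ length-filter-¬ (λ x → g x ℕ.≟ n) xs ⟩
    length (filter (λ x → g x ℕ.≟ n) xs) + length rest
      ≡⟨ ℕ.+-comm (length (filter (λ x → g x ℕ.≟ n) xs)) (length rest) ⟩
    length rest + length (filter (λ x → g x ℕ.≟ n) xs)
      ≤⟨ ℕ.+-monoˡ-≤ _ (fibre-count g n rest! below) ⟩
    sumTo n (λ k → length (filter (λ x → g x ℕ.≟ k) rest)) + length (filter (λ x → g x ℕ.≟ n) xs)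
      ≤⟨ ℕ.+-monoˡ-≤ _ (sumTo-mono n (λ {k} _ → injection⇒length≤ (Unique.filter⁺ (λ x → g x ℕ.≟ k) rest!)
           id (λ _ _ → id) (widen k))) ⟩
    sumTo (suc n) (λ k → length (filter (λ x → g x ℕ.≟ k) xs)) ∎
    where
    open ℕ.≤-Reasoning
    rest = filter (λ x → ¬? (g x ℕ.≟ n)) xs
    rest! : Unique rest
    rest! = Unique.filter⁺ (λ x → ¬? (g x ℕ.≟ n)) u
    below : ∀ {x} → x ∈ rest → g x < n
    below x∈ with x∈xs , gx≢n ← ∈-filter⁻ (λ x → ¬? (g x ℕ.≟ n)) {xs = xs} x∈ =
      ℕ.≤∧≢⇒< (ℕ.s≤s⁻¹ (g<n x∈xs)) gx≢n
    widen : ∀ k {x} → x ∈ filter (λ x → g x ℕ.≟ k) rest → x ∈ filter (λ x → g x ℕ.≟ k) xs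
    widen k x∈ with x∈rest , gx≡k ← ∈-filter⁻ (λ x → g x ℕ.≟ k) {xs = rest} x∈ =
      ∈-filter⁺ (λ x → g x ℕ.≟ k) (proj₁ (∈-filter⁻ (λ x → ¬? (g x ℕ.≟ n)) {xs = xs} x∈rest)) gx≡k

  octant : ℕ → List (ℕ × ℕ)
  octant M = filter (λ (i , j) → j ℕ.≤? i) (cells M)

  octant-unique : ∀ M → Unique (octant M)
  octant-unique M = Unique.filter⁺ _ (cells-unique M)

  ∈-octant⁻ : ∀ {M i j} → (i , j) ∈ octant M → suc i * suc i + suc j * suc j ≤ M * M × j ≤ i
  ∈-octant⁻ {M} p with p∈ , j≤i ← ∈-filter⁻ (λ (i , j) → j ℕ.≤? i) {xs = cells M} p = ∈-cells⁻ p∈ , j≤i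

  ∈-octant⁺ : ∀ {M i j} → suc i * suc i + suc j * suc j ≤ M * M → j ≤ i → (i , j) ∈ octant M
  ∈-octant⁺ h j≤i = ∈-filter⁺ (λ (i , j) → j ℕ.≤? i) (∈-cells⁺ h) j≤i

  -- Squares on the diagonal belong to both copies of the octant, hence only an inequality.
  #cells≤octants : ∀ M → #cells M ≤ length (octant M) + length (octant M)
  #cells≤octants M = begin
    #cells M      ≤⟨ injection⇒length≤ (cells-unique M) fold inj into ⟩
    length target ≡⟨ trans (length-++ (map inj₁ (octant M))) (cong₂ _+_ (length-map inj₁ (octant M)) (length-map inj₂ (octant M))) ⟩
    length (octant M) + length (octant M) ∎
    where
    open ℕ.≤-Reasoning
    target : List ((ℕ × ℕ) ⊎ (ℕ × ℕ))
    target = map inj₁ (octant M) ++ map inj₂ (octant M)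
    fold : ℕ × ℕ → (ℕ × ℕ) ⊎ (ℕ × ℕ)
    fold (i , j) with j ℕ.≤? i
    ... | yes _ = inj₁ (i , j)
    ... | no  _ = inj₂ (j , i)
    inj : ∀ {x y} → x ∈ cells M → y ∈ cells M → fold x ≡ fold y → x ≡ y
    inj {i , j} {k , l} _ _ eq with j ℕ.≤? i | l ℕ.≤? k
    ... | yes _ | yes _ with refl ← inj₁-injective eq = refl
    ... | no  _ | no  _ with refl ← inj₂-injective eq = refl
    into : ∀ {x} → x ∈ cells M → fold x ∈ target
    into {i , j} p with j ℕ.≤? i
    ... | yes j≤i = ∈-++⁺ˡ (∈-map⁺ inj₁ (∈-octant⁺ (∈-cells⁻ p) j≤i))
    ... | no  j≰i = ∈-++⁺ʳ (map inj₁ (octant M)) (∈-map⁺ inj₂ (∈-octant⁺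
      (subst (_≤ M * M) (ℕ.+-comm (suc i * suc i) (suc j * suc j)) (∈-cells⁻ p)) (ℕ.<⇒≤ (ℕ.≰⇒> j≰i))))

  module Sectors (M K : ℕ) .{{_ : NonZero K}} where

    -- The sector k contains the unit squares whose lower right corner (i+1 , j)
    -- has slope in [k/K , (k+1)/K).
    sector : ℕ × ℕ → ℕ
    sector (i , j) = j * K / suc i

    sector<K : ∀ {p} → p ∈ octant M → sector p < K
    sector<K {i , j} p = m<n*o⇒m/o<n {j * K} {K} {suc i} (subst (j * K <_) (ℕ.*-comm (suc i) K) (ℕ.*-monoˡ-< K (s≤s (proj₂ (∈-octant⁻ {M} p)))))

    inSector : ℕ → List (ℕ × ℕ)
    inSector k = filter (λ p → sector p ℕ.≟ k) (octant M)

    inSector-unique : ∀ k → Unique (inSector k)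
    inSector-unique k = Unique.filter⁺ _ (octant-unique M)

    ∈-inSector⁻ : ∀ {k i j} → (i , j) ∈ inSector k →
      suc i * suc i + suc j * suc j ≤ M * M × k * suc i ≤ j * K × j * K < suc k * suc i
    ∈-inSector⁻ {k} {i} {j} p with p∈ , refl ← ∈-filter⁻ (λ p → sector p ℕ.≟ k) {xs = octant M} p =
      proj₁ (∈-octant⁻ {M} p∈) , m/n*n≤m (j * K) (suc i) , (begin-strict
        j * K                                         ≡⟨ m≡m%n+[m/n]*n (j * K) (suc i) ⟩
        j * K ℕ.% suc i + j * K / suc i * suc i       <⟨ ℕ.+-monoˡ-< _ (m%n<n (j * K) (suc i)) ⟩
        suc (j * K / suc i) * suc i                   ∎)
      where open ℕ.≤-Reasoning

    -- The point (X , X k / K) on the lower ray of sector `k` lies in the disc of radius `M`, with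
    -- denominators cleared.
    Within : ℕ → ℕ → Set
    Within k X = X * X * (K * K + k * k) ≤ K * K * (M * M)

    within? : ∀ k → Decidable (Within k)
    within? k X = _ ℕ.≤? _

    Within⇒≤M : ∀ {k X} → Within k X → X ≤ M
    Within⇒≤M {k} {X} h = ²-cancel-≤ (ℕ.*-cancelˡ-≤ (K * K) {{ℕ.m*n≢0 K K}} (begin
      K * K * (X * X)            ≡⟨ ℕ.*-comm (K * K) (X * X) ⟩
      X * X * (K * K)            ≤⟨ ℕ.*-monoʳ-≤ (X * X) (ℕ.m≤m+n (K * K) (k * k)) ⟩
      X * X * (K * K + k * k)    ≤⟨ h ⟩
      K * K * (M * M)            ∎))
      where open ℕ.≤-Reasoning

    Within-anti : ∀ {k X Y} → X ≤ Y → Within k Y → Within k X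
    Within-anti {k} X≤Y h = ℕ.≤-trans (ℕ.*-monoˡ-≤ (K * K + k * k) (ℕ.*-mono-≤ X≤Y X≤Y)) h

    reachΣ : ∀ k → ∃ λ X → Within k X × ¬ Within k (suc X)
    reachΣ k = greatest (within? k) z≤n (suc M) (λ h → ℕ.1+n≰n (Within⇒≤M {k} h))

    -- The integer part of M / √(1 + t²) for t = k / K, so its square approximates a term of the
    -- Riemann sum.
    reach : ℕ → ℕ
    reach k = proj₁ (reachΣ k)

    reach-within : ∀ k → Within k (reach k)
    reach-within k = proj₁ (proj₂ (reachΣ k))

    reach-greatest : ∀ {k X} → Within k X → X ≤ reach k
    reach-greatest {k} h = ℕ.≮⇒≥ λ lt → proj₂ (proj₂ (reachΣ k)) (Within-anti {k} lt h)

    -- The upper right corner lies in the disc, and the lower right corner lies on or above the ray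
    -- of slope k / K; hence the point of the ray with abscissa `suc i` lies in the disc too.
    inSector-within : ∀ {k i j} → (i , j) ∈ inSector k → Within k (suc i)
    inSector-within {k} {i} {j} p with norm≤ , k≤ , _ ← ∈-inSector⁻ {k} p = begin
      suc i * suc i * (K * K + k * k)                  ≡⟨ expand (suc i) K k ⟩
      K * K * (suc i * suc i) + k * suc i * (k * suc i) ≤⟨ ℕ.+-monoʳ-≤ (K * K * (suc i * suc i)) (ℕ.*-mono-≤ k≤′ k≤′) ⟩
      K * K * (suc i * suc i) + suc j * K * (suc j * K) ≡⟨ collect (suc i) K (suc j) ⟩
      K * K * (suc i * suc i + suc j * suc j)          ≤⟨ ℕ.*-monoʳ-≤ (K * K) norm≤ ⟩
      K * K * (M * M)                                  ∎
      where
      open ℕ.≤-Reasoning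
      k≤′ : k * suc i ≤ suc j * K
      k≤′ = ℕ.≤-trans k≤ (ℕ.*-monoˡ-≤ K (ℕ.n≤1+n j))
      expand : ∀ x K k → x * x * (K * K + k * k) ≡ K * K * (x * x) + k * x * (k * x)
      expand = solve-∀
      collect : ∀ x K y → K * K * (x * x) + y * K * (y * K) ≡ K * K * (x * x + y * y)
      collect = solve-∀

    column : ℕ → ℕ → List (ℕ × ℕ)
    column k x = filter (λ p → proj₁ p ℕ.≟ x) (inSector k)

    -- The admissible `j` form a half-open interval of length (x + 1) / K. One of the two extra
    -- units pays for rounding its lower end down to `base`, the other for rounding down its length.
    length-column : ∀ k x → length (column k x) ≤ suc (suc (suc x / K))
    length-column k x = ℕ.≤-trans
      (injection⇒length≤ (Unique.filter⁺ _ (inSector-unique k)) (λ (_ , j) → j ∸ base) inj into)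
      (ℕ.≤-reflexive (length-upTo (suc (suc (suc x / K)))))
      where
      base = k * suc x / K
      base*K≤ : base * K ≤ k * suc x
      base*K≤ = m/n*n≤m (k * suc x) K
      column⁻ : ∀ {i j} → (i , j) ∈ column k x → i ≡ x × base ≤ j × j * K < suc k * suc x
      column⁻ p with p∈ , refl ← ∈-filter⁻ (λ p → proj₁ p ℕ.≟ x) {xs = inSector k} p
                with _ , k≤ , <k ← ∈-inSector⁻ {k} p∈ =
        refl , ℕ.*-cancelʳ-≤ base _ K (ℕ.≤-trans base*K≤ k≤) , <k
      inj : ∀ {p q} → p ∈ column k x → q ∈ column k x → proj₂ p ∸ base ≡ proj₂ q ∸ base → p ≡ q
      inj p q eq with refl , b≤p , _ ← column⁻ p | refl , b≤q , _ ← column⁻ q =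
        cong (_ ,_) (ℕ.∸-cancelʳ-≡ b≤p b≤q eq)
      into : ∀ {p} → p ∈ column k x → proj₂ p ∸ base ∈ upTo (suc (suc (suc x / K)))
      into {_ , j} p with refl , b≤j , <k ← column⁻ p with d , refl ← ℕ.m≤n⇒∃[o]m+o≡n b≤j =
        subst (_∈ upTo (suc (suc (suc x / K)))) (sym (ℕ.m+n∸m≡n base d)) (∈-upTo⁺ (ℕ.≰⇒> λ too-far → ℕ.<⇒≱ <k (begin
          suc k * suc x                                       ≡⟨⟩
          suc x + k * suc x                                   ≤⟨ ℕ.+-mono-≤ (<next (suc x)) (<next (k * suc x)) ⟩
          suc (suc x / K) * K + suc base * K                  ≡⟨ regroup (suc x / K) base K ⟩
          (base + suc (suc (suc x / K))) * K                  ≤⟨ ℕ.*-monoˡ-≤ K (ℕ.+-monoʳ-≤ base too-far) ⟩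
          (base + d) * K                                      ∎)))
        where
        open ℕ.≤-Reasoning
        <next : ∀ n → n ≤ suc (n / K) * K
        <next n = ℕ.≤-trans (ℕ.≤-reflexive (m≡m%n+[m/n]*n n K)) (ℕ.+-monoˡ-≤ (n / K * K) (ℕ.<⇒≤ (m%n<n n K)))
        regroup : ∀ a b K → suc a * K + suc b * K ≡ (b + suc (suc a)) * K
        regroup = solve-∀

    -- X² / 2K is the area of the triangle between two neighbouring rays up to abscissa `X`. After
    -- scaling, column `x` contributes at most 2 (x + 1) + 4 K; these add up to X² + X + 4 K X, and
    -- the stray X is absorbed because K ≥ 1.
    columns-sum : ∀ X → 2 * K * sumTo X (λ x → suc (suc (suc x / K))) ≤ X * X + 5 * K * X
    columns-sum zero    = ℕ.≤-trans (ℕ.≤-reflexive (ℕ.*-zeroʳ (2 * K))) z≤n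
    columns-sum (suc X) = begin
      2 * K * (sumTo X (λ x → suc (suc (suc x / K))) + suc (suc (suc X / K)))
        ≡⟨ distrib K (sumTo X (λ x → suc (suc (suc x / K)))) (suc X / K) ⟩
      2 * K * sumTo X (λ x → suc (suc (suc x / K))) + (2 * (suc X / K * K) + 4 * K)
        ≤⟨ ℕ.+-mono-≤ (columns-sum X) (ℕ.+-monoˡ-≤ (4 * K) (ℕ.*-monoʳ-≤ 2 (m/n*n≤m (suc X) K))) ⟩
      X * X + 5 * K * X + (2 * suc X + 4 * K)
        ≤⟨ ℕ.+-monoʳ-≤ (X * X + 5 * K * X) (ℕ.≤-trans (ℕ.≤-reflexive (split X K)) (ℕ.+-monoʳ-≤ (2 * X + 1 + 4 * K) (ℕ.>-nonZero⁻¹ K))) ⟩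
      X * X + 5 * K * X + (2 * X + 1 + 4 * K + K)
        ≡⟨ close X K ⟩
      suc X * suc X + 5 * K * suc X ∎
      where
      open ℕ.≤-Reasoning
      distrib : ∀ K s q → 2 * K * (s + suc (suc q)) ≡ 2 * K * s + (2 * (q * K) + 4 * K)
      distrib = solve-∀
      split : ∀ X K → 2 * suc X + 4 * K ≡ 2 * X + 1 + 4 * K + 1
      split = solve-∀
      close : ∀ X K → X * X + 5 * K * X + (2 * X + 1 + 4 * K + K) ≡ suc X * suc X + 5 * K * suc X
      close = solve-∀

    -- The squares of the sector end at abscissa `reach k`, so they are counted by that triangle;
    -- the linear term collects the roundings of the columns.
    length-inSector : ∀ k → 2 * K * length (inSector k) ≤ reach k * reach k + 5 * K * M
    length-inSector k = begin
      2 * K * length (inSector k)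
        ≤⟨ ℕ.*-monoʳ-≤ (2 * K) (ℕ.≤-trans (fibre-count proj₁ (reach k) (inSector-unique k) (λ p → reach-greatest {k} (inSector-within {k} p)))
             (sumTo-mono (reach k) (λ {x} _ → length-column k x))) ⟩
      2 * K * sumTo (reach k) (λ x → suc (suc (suc x / K)))
        ≤⟨ columns-sum (reach k) ⟩
      reach k * reach k + 5 * K * reach k
        ≤⟨ ℕ.+-monoʳ-≤ (reach k * reach k) (ℕ.*-monoʳ-≤ (5 * K) (Within⇒≤M {k} (reach-within k))) ⟩
      reach k * reach k + 5 * K * M ∎
      where open ℕ.≤-Reasoning

    #cells-sectors : K * #cells M ≤ sumTo K (λ k → reach k * reach k) + K * (5 * K * M)
    #cells-sectors = begin
      K * #cells M                                        ≤⟨ ℕ.*-monoʳ-≤ K (#cells≤octants M) ⟩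
      K * (length (octant M) + length (octant M))         ≡⟨ double K (length (octant M)) ⟩
      2 * K * length (octant M)                           ≤⟨ ℕ.*-monoʳ-≤ (2 * K) (fibre-count sector K (octant-unique M) sector<K) ⟩
      2 * K * sumTo K (λ k → length (inSector k))         ≤⟨ sum K ⟩
      sumTo K (λ k → reach k * reach k) + K * (5 * K * M) ∎
      where
      open ℕ.≤-Reasoning
      double : ∀ K n → K * (n + n) ≡ 2 * K * n
      double = solve-∀
      regroup : ∀ a b c d → a + b + (c + d) ≡ a + c + (d + b)
      regroup = solve-∀
      sum : ∀ n → 2 * K * sumTo n (λ k → length (inSector k)) ≤ sumTo n (λ k → reach k * reach k) + n * (5 * K * M)
      sum zero    = ℕ.≤-trans (ℕ.≤-reflexive (ℕ.*-zeroʳ (2 * K))) z≤n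
      sum (suc n) = begin
        2 * K * (sumTo n (λ k → length (inSector k)) + length (inSector n))
          ≡⟨ ℕ.*-distribˡ-+ (2 * K) (sumTo n (λ k → length (inSector k))) (length (inSector n)) ⟩
        2 * K * sumTo n (λ k → length (inSector k)) + 2 * K * length (inSector n)
          ≤⟨ ℕ.+-mono-≤ (sum n) (length-inSector n) ⟩
        sumTo n (λ k → reach k * reach k) + n * (5 * K * M) + (reach n * reach n + 5 * K * M)
          ≡⟨ regroup (sumTo n (λ k → reach k * reach k)) (n * (5 * K * M)) (reach n * reach n) (5 * K * M) ⟩
        sumTo (suc n) (λ k → reach k * reach k) + suc n * (5 * K * M) ∎

  -- Choice of the radius

  cube : ℕ → ℕ
  cube w = w * w * w

  -- m ↦ m² N / (m + N) is increasing, so it suffices to compare at the bound.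
  quadratic-bound : ∀ {m N S E F} .{{_ : NonZero N}} → m * m * N ≤ S * (m + N) → S ≤ E * E →
    E * (2 * E + F) ≤ 2 * F * N → 2 * m ≤ 2 * E + F
  quadratic-bound {m} {N} {S} {E} {F} mmN≤ S≤ hF = ℕ.≮⇒≥ λ Y<2m → absurd Y<2m
    where
    open ℕ.≤-Reasoning
    -- The bound E + F / 2 need not be an integer, so `2 * m` is compared instead of `m`.
    Y = 2 * E + F
    double : ∀ m N → 2 * m * (2 * m) * N ≡ 4 * (m * m * N)
    double = solve-∀
    double′ : ∀ e m N → 4 * (e * (m + N)) ≡ e * (2 * (2 * m) + 4 * N)
    double′ = solve-∀
    at-2m : 2 * m * (2 * m) * N ≤ E * E * (2 * (2 * m) + 4 * N)
    at-2m = begin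
      2 * m * (2 * m) * N            ≡⟨ double m N ⟩
      4 * (m * m * N)                ≤⟨ ℕ.*-monoʳ-≤ 4 (ℕ.≤-trans mmN≤ (ℕ.*-monoˡ-≤ (m + N) S≤)) ⟩
      4 * (E * E * (m + N))          ≡⟨ double′ (E * E) m N ⟩
      E * E * (2 * (2 * m) + 4 * N)  ∎
    left : ∀ E F N → E * E * (2 * (2 * E + F) + 4 * N) ≡ 2 * E * (E * (2 * E + F)) + 4 * E * E * N
    left = solve-∀
    right : ∀ E F N → 2 * E * (2 * F * N) + 4 * E * E * N + F * F * N ≡ (2 * E + F) * (2 * E + F) * N
    right = solve-∀
    -- The hypothesis `hF` is made for this: at `Y` the inequality opposite to `at-2m` already
    -- holds.
    at-Y : E * E * (2 * Y + 4 * N) ≤ Y * Y * N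
    at-Y = begin
      E * E * (2 * Y + 4 * N)                          ≡⟨ left E F N ⟩
      2 * E * (E * Y) + 4 * E * E * N                  ≤⟨ ℕ.+-monoˡ-≤ (4 * E * E * N) (ℕ.*-monoʳ-≤ (2 * E) hF) ⟩
      2 * E * (2 * F * N) + 4 * E * E * N              ≤⟨ ℕ.m≤m+n _ (F * F * N) ⟩
      2 * E * (2 * F * N) + 4 * E * E * N + F * F * N  ≡⟨ right E F N ⟩
      Y * Y * N                                        ∎
    -- Ensures that beyond `Y` the side quadratic in the argument grows faster: an increase by d + 1
    -- adds at least 2 (d + 1) Y N to it, and 2 (d + 1) E² to the other side.
    EE≤YN : E * E ≤ Y * N
    EE≤YN = ℕ.*-cancelˡ-≤ 2 (begin
      2 * (E * E)          ≤⟨ ℕ.m≤m+n _ (E * F) ⟩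
      2 * (E * E) + E * F  ≡⟨ e₁ E F ⟩
      E * Y                ≤⟨ hF ⟩
      2 * F * N            ≤⟨ ℕ.m≤m+n _ (4 * E * N) ⟩
      2 * F * N + 4 * E * N ≡⟨ e₂ E F N ⟩
      2 * (Y * N)          ∎)
      where
      e₁ : ∀ E F → 2 * (E * E) + E * F ≡ E * (2 * E + F)
      e₁ = solve-∀
      e₂ : ∀ E F N → 2 * F * N + 4 * E * N ≡ 2 * ((2 * E + F) * N)
      e₂ = solve-∀
    absurd : ¬ Y < 2 * m
    absurd Y<2m with d , eq ← ℕ.m≤n⇒∃[o]m+o≡n Y<2m = ℕ.<⇒≱ (begin-strict
      E * E * (2 * (2 * m) + 4 * N)            ≡⟨ cong (λ z → E * E * (2 * z + 4 * N)) eq ⟨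
      E * E * (2 * (suc Y + d) + 4 * N)        ≡⟨ e₃ (E * E) Y d N ⟩
      E * E * (2 * Y + 4 * N) + 2 * suc d * (E * E)
        ≤⟨ ℕ.+-mono-≤ at-Y (ℕ.*-monoʳ-≤ (2 * suc d) EE≤YN) ⟩
      Y * Y * N + 2 * suc d * (Y * N)
        <⟨ ℕ.m<m+n _ (ℕ.>-nonZero⁻¹ (suc d * suc d * N) {{ℕ.m*n≢0 (suc d * suc d) N}}) ⟩
      Y * Y * N + 2 * suc d * (Y * N) + suc d * suc d * N ≡⟨ e₄ Y d N ⟩
      (suc Y + d) * (suc Y + d) * N            ≡⟨ cong (λ z → z * z * N) eq ⟩
      2 * m * (2 * m) * N                      ∎) at-2m
      where
      e₃ : ∀ e Y d N → e * (2 * (suc Y + d) + 4 * N) ≡ e * (2 * Y + 4 * N) + 2 * suc d * e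
      e₃ = solve-∀
      e₄ : ∀ Y d N → Y * Y * N + 2 * suc d * (Y * N) + suc d * suc d * N ≡ (suc Y + d) * (suc Y + d) * N
      e₄ = solve-∀

  -- q plays the role of π r² / 4; A and w are the integer parts of its square and
  -- sixth roots, and R ≈ r / 2w is the radius of the covering discs.
  module Estimates {q r w A R : ℕ} .{{_ : NonZero r}} .{{_ : NonZero w}} .{{_ : NonZero A}}
    (A²≤q : A * A ≤ q) (q<A² : q < suc A * suc A) (w⁶≤q : cube w * cube w ≤ q) (q<w⁶ : q < cube (suc w) * cube (suc w))
    (A≤r : A ≤ r) (r≤3A : r ≤ 3 * A) (r≤2wR : r ≤ 2 * w * R) (2wR≤ : 2 * w * R ≤ r + 2 * w) where

    open ℕ.≤-Reasoning

    1≤w : 1 ≤ w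
    1≤w = ℕ.>-nonZero⁻¹ w

    1≤A : 1 ≤ A
    1≤A = ℕ.>-nonZero⁻¹ A

    -- (w + 1)³ - 1 is written with the factor `w`, so that A / w can be bounded without division.
    A≤w³ : A ≤ w * (w * w + 3 * w + 3)
    A≤w³ = ℕ.s≤s⁻¹ (ℕ.≤-trans (²-cancel-< (ℕ.≤-<-trans A²≤q q<w⁶)) (ℕ.≤-reflexive (expand w)))
      where
      expand : ∀ w → suc w * suc w * suc w ≡ suc (w * (w * w + 3 * w + 3))
      expand = solve-∀

    -- `E` will bound √S. The dilation factor D / r is about 1 + 1 / w, and A / w ≤ w² + 3 w + 3 by
    -- `A≤w³`. The constant 21 is 4 + 3 + 4 + 10, collected in `D-dilation`; passing from `E₀` to
    -- `E` makes room for the points on the axes.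
    E₀ E : ℕ
    E₀ = A + w * w + 3 * w + 21
    E = A + w * w + 38 * w

    D : ℕ
    D = r + (R + R)

    D≤4r : D ≤ 4 * r
    D≤4r = ℕ.*-cancelˡ-≤ w (begin
      w * (r + (R + R))        ≡⟨ e₁ w r R ⟩
      w * r + 2 * w * R        ≤⟨ ℕ.+-monoʳ-≤ (w * r) 2wR≤ ⟩
      w * r + (r + 2 * w)      ≡⟨ e₂ w r ⟩
      w * r + 1 * r + 2 * w * 1
        ≤⟨ ℕ.+-mono-≤ (ℕ.+-monoʳ-≤ (w * r) (ℕ.*-monoˡ-≤ r 1≤w)) (ℕ.*-monoʳ-≤ (2 * w) (ℕ.>-nonZero⁻¹ r)) ⟩
      w * r + w * r + 2 * w * r ≡⟨ e₃ w r ⟩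
      w * (4 * r)              ∎)
      where
      e₁ : ∀ w r R → w * (r + (R + R)) ≡ w * r + 2 * w * R
      e₁ = solve-∀
      e₂ : ∀ w r → w * r + (r + 2 * w) ≡ w * r + 1 * r + 2 * w * 1
      e₂ = solve-∀
      e₃ : ∀ w r → w * r + w * r + 2 * w * r ≡ w * (4 * r)
      e₃ = solve-∀

    D-dilation : D * (A + 4) ≤ r * E₀
    D-dilation = ℕ.*-cancelˡ-≤ w (begin
      w * (D * (A + 4))                        ≡⟨ e₁ w r R A ⟩
      (w * r + 2 * w * R) * (A + 4)            ≤⟨ ℕ.*-monoˡ-≤ (A + 4) (ℕ.+-monoʳ-≤ (w * r) 2wR≤) ⟩
      (w * r + (r + 2 * w)) * (A + 4)          ≡⟨ e₂ w r A ⟩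
      w * r * (A + 4) + r * (A + 4 * 1) + 2 * w * (A + 4 * 1)
        ≤⟨ ℕ.+-mono-≤ (ℕ.+-monoʳ-≤ (w * r * (A + 4)) (ℕ.*-monoʳ-≤ r (ℕ.+-mono-≤ A≤w³ (ℕ.*-monoʳ-≤ 4 1≤w))))
             (ℕ.*-monoʳ-≤ (2 * w) (ℕ.+-mono-≤ A≤r (ℕ.*-monoʳ-≤ 4 (ℕ.>-nonZero⁻¹ r)))) ⟩
      w * r * (A + 4) + r * (w * (w * w + 3 * w + 3) + 4 * w) + 2 * w * (r + 4 * r)
        ≡⟨ e₃ w r A ⟩
      w * (r * E₀)                             ∎)
      where
      e₁ : ∀ w r R A → w * ((r + (R + R)) * (A + 4)) ≡ (w * r + 2 * w * R) * (A + 4)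
      e₁ = solve-∀
      e₂ : ∀ w r A → (w * r + (r + 2 * w)) * (A + 4) ≡ w * r * (A + 4) + r * (A + 4 * 1) + 2 * w * (A + 4 * 1)
      e₂ = solve-∀
      e₃ : ∀ w r A → w * r * (A + 4) + r * (w * (w * w + 3 * w + 3) + 4 * w) + 2 * w * (r + 4 * r) ≡
        w * (r * (A + w * w + 3 * w + 21))
      e₃ = solve-∀

    -- The axes contribute at most 6 A + 1 points, which raises the bound A + 1 on the root only to
    -- A + 4.
    q+axes≤ : q + (r + suc r) ≤ (A + 4) * (A + 4)
    q+axes≤ = begin
      q + (r + suc r)                    ≤⟨ ℕ.+-mono-≤ (ℕ.<⇒≤ q<A²) (ℕ.+-mono-≤ r≤3A (s≤s r≤3A)) ⟩
      suc A * suc A + (3 * A + suc (3 * A)) ≤⟨ ℕ.m≤m+n _ 14 ⟩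
      suc A * suc A + (3 * A + suc (3 * A)) + 14 ≡⟨ e A ⟩
      (A + 4) * (A + 4)                  ∎
      where
      e : ∀ A → suc A * suc A + (3 * A + suc (3 * A)) + 14 ≡ (A + 4) * (A + 4)
      e = solve-∀

    S-bound : ∀ {S} → r * r * S ≤ D * D * (q + (r + suc r)) + r * r * (D + suc D) → S ≤ E * E
    S-bound {S} h = ℕ.*-cancelˡ-≤ (r * r) {{ℕ.m*n≢0 r r}} (begin
      r * r * S
        ≤⟨ h ⟩
      D * D * (q + (r + suc r)) + r * r * (D + suc D)
        ≤⟨ ℕ.+-mono-≤ (ℕ.*-monoʳ-≤ (D * D) q+axes≤) (ℕ.*-monoʳ-≤ (r * r) 2D+1≤) ⟩
      D * D * ((A + 4) * (A + 4)) + r * r * (28 * E₀)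
        ≡⟨ cong (_+ r * r * (28 * E₀)) (e₁ D (A + 4)) ⟩
      D * (A + 4) * (D * (A + 4)) + r * r * (28 * E₀)
        ≤⟨ ℕ.+-monoˡ-≤ (r * r * (28 * E₀)) (ℕ.*-mono-≤ D-dilation D-dilation) ⟩
      r * E₀ * (r * E₀) + r * r * (28 * E₀)
        -- 196 = 14² completes the square that begins with E₀² + 28 E₀.
        ≤⟨ ℕ.m≤m+n _ (r * r * 196) ⟩
      r * E₀ * (r * E₀) + r * r * (28 * E₀) + r * r * 196
        ≡⟨ e₂ r E₀ ⟩
      r * r * ((E₀ + 14) * (E₀ + 14))
        ≤⟨ ℕ.*-monoʳ-≤ (r * r) (ℕ.*-mono-≤ E₀+14≤E E₀+14≤E) ⟩
      r * r * (E * E) ∎)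
      where
      e₁ : ∀ a b → a * a * (b * b) ≡ a * b * (a * b)
      e₁ = solve-∀
      e₂ : ∀ r e → r * e * (r * e) + r * r * (28 * e) + r * r * 196 ≡ r * r * ((e + 14) * (e + 14))
      e₂ = solve-∀
      e₃ : ∀ A w → A + w * w + 3 * w + 21 + 14 ≡ A + w * w + 3 * w + 35 * 1
      e₃ = solve-∀
      e₄ : ∀ A w → A + w * w + 3 * w + 35 * w ≡ A + w * w + 38 * w
      e₄ = solve-∀
      e₅ : ∀ A w → 28 * A + 28 * (w * w + 3 * w + 21) ≡ 28 * (A + w * w + 3 * w + 21)
      e₅ = solve-∀
      e₆ : ∀ r → 4 * r + suc (4 * r) ≡ 8 * r + 1
      e₆ = solve-∀
      e₇ : ∀ A → 8 * (3 * A) + A ≡ 25 * A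
      e₇ = solve-∀
      E₀+14≤E : E₀ + 14 ≤ E
      E₀+14≤E = begin
        E₀ + 14                        ≡⟨ e₃ A w ⟩
        A + w * w + 3 * w + 35 * 1     ≤⟨ ℕ.+-monoʳ-≤ (A + w * w + 3 * w) (ℕ.*-monoʳ-≤ 35 1≤w) ⟩
        A + w * w + 3 * w + 35 * w     ≡⟨ e₄ A w ⟩
        E                              ∎
      2D+1≤ : D + suc D ≤ 28 * E₀
      2D+1≤ = begin
        D + suc D                  ≤⟨ ℕ.+-mono-≤ D≤4r (s≤s D≤4r) ⟩
        4 * r + suc (4 * r)        ≡⟨ e₆ r ⟩
        8 * r + 1                  ≤⟨ ℕ.+-mono-≤ (ℕ.*-monoʳ-≤ 8 r≤3A) 1≤A ⟩
        8 * (3 * A) + A            ≡⟨ e₇ A ⟩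
        25 * A                     ≤⟨ ℕ.*-monoˡ-≤ A (ℕ.m≤m+n 25 3) ⟩
        28 * A                     ≤⟨ ℕ.m≤m+n _ (28 * (w * w + 3 * w + 21)) ⟩
        28 * A + 28 * (w * w + 3 * w + 21) ≡⟨ e₅ A w ⟩
        28 * E₀                    ∎

    r≤w³ : r ≤ 21 * cube w
    r≤w³ = begin
      r                                 ≤⟨ r≤3A ⟩
      3 * A                             ≤⟨ ℕ.*-monoʳ-≤ 3 A≤w³ ⟩
      3 * (w * (w * w + 3 * w + 3))     ≡⟨ e₁ w ⟩
      3 * (w * w * w) + 9 * (w * w * 1) + 9 * (w * 1 * 1)
        ≤⟨ ℕ.+-mono-≤ (ℕ.+-monoʳ-≤ (3 * (w * w * w)) (ℕ.*-monoʳ-≤ 9 (ℕ.*-monoʳ-≤ (w * w) 1≤w)))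
             (ℕ.*-monoʳ-≤ 9 (ℕ.*-mono-≤ (ℕ.*-monoʳ-≤ w 1≤w) 1≤w)) ⟩
      3 * (w * w * w) + 9 * (w * w * w) + 9 * (w * w * w) ≡⟨ e₂ w ⟩
      21 * cube w                       ∎
      where
      e₁ : ∀ w → 3 * (w * (w * w + 3 * w + 3)) ≡ 3 * (w * w * w) + 9 * (w * w * 1) + 9 * (w * 1 * 1)
      e₁ = solve-∀
      e₂ : ∀ w → 3 * (w * w * w) + 9 * (w * w * w) + 9 * (w * w * w) ≡ 21 * (w * w * w)
      e₂ = solve-∀

    -- Since 2 w R ≥ r, the factor 4 R² / r² is at least 1 / w², so `N` is at least q / w² up to the
    -- boundary term 8 R + 4. Multiplied by w² this term is O(w⁴), because 2 w R ≤ r + 2 w and r ≤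
    -- 21 w³.
    N-bound : ∀ {N} → 4 * (R * R * q) ≤ r * r * (N + (8 * R + 4)) → q ≤ w * w * N + 96 * (w * cube w)
    N-bound {N} h = begin
      q                                      ≤⟨ ℕ.*-cancelˡ-≤ (r * r) {{ℕ.m*n≢0 r r}} scaled ⟩
      w * w * (N + (8 * R + 4))              ≡⟨ e₁ w N R ⟩
      w * w * N + (4 * w * (2 * w * R) + 4 * (w * w))
        ≤⟨ ℕ.+-monoʳ-≤ (w * w * N) (ℕ.+-monoˡ-≤ (4 * (w * w)) (ℕ.*-monoʳ-≤ (4 * w) (ℕ.≤-trans 2wR≤ (ℕ.+-monoˡ-≤ (2 * w) r≤w³)))) ⟩
      w * w * N + (4 * w * (21 * cube w + 2 * w) + 4 * (w * w))
        ≡⟨ cong (λ x → w * w * N + x) (e₂ w) ⟩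
      w * w * N + (84 * (w * (w * w * w)) + 12 * (w * (w * 1 * 1)))
        ≤⟨ ℕ.+-monoʳ-≤ (w * w * N) (ℕ.+-monoʳ-≤ (84 * (w * (w * w * w)))
             (ℕ.*-monoʳ-≤ 12 (ℕ.*-monoʳ-≤ w (ℕ.*-mono-≤ (ℕ.*-monoʳ-≤ w 1≤w) 1≤w)))) ⟩
      w * w * N + (84 * (w * (w * w * w)) + 12 * (w * (w * w * w)))
        ≡⟨ cong (λ x → w * w * N + x) (e₃ (w * (w * w * w))) ⟩
      w * w * N + 96 * (w * cube w)          ∎
      where
      e₁ : ∀ w N R → w * w * (N + (8 * R + 4)) ≡ w * w * N + (4 * w * (2 * w * R) + 4 * (w * w))
      e₁ = solve-∀
      e₂ : ∀ w → 4 * w * (21 * (w * w * w) + 2 * w) + 4 * (w * w) ≡ 84 * (w * (w * w * w)) + 12 * (w * (w * 1 * 1))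
      e₂ = solve-∀
      e₃ : ∀ x → 84 * x + 12 * x ≡ 96 * x
      e₃ = solve-∀
      e₄ : ∀ w R q → 2 * w * R * (2 * w * R) * q ≡ w * w * (4 * (R * R * q))
      e₄ = solve-∀
      e₅ : ∀ w r n → w * w * (r * r * n) ≡ r * r * (w * w * n)
      e₅ = solve-∀
      scaled : r * r * q ≤ r * r * (w * w * (N + (8 * R + 4)))
      scaled = begin
        r * r * q                            ≤⟨ ℕ.*-monoˡ-≤ q (ℕ.*-mono-≤ r≤2wR r≤2wR) ⟩
        2 * w * R * (2 * w * R) * q          ≡⟨ e₄ w R q ⟩
        w * w * (4 * (R * R * q))            ≤⟨ ℕ.*-monoʳ-≤ (w * w) h ⟩
        w * w * (r * r * (N + (8 * R + 4)))  ≡⟨ e₅ w r (N + (8 * R + 4)) ⟩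
        r * r * (w * w * (N + (8 * R + 4)))  ∎

    -- Twice the correction S / 2N, which is about w² / 2 since `S` is about q and `N` about q / w².
    -- The additional 10 w is there to outweigh the lower-order terms in `F-bound`.
    F : ℕ
    F = w * w + 10 * w

    -- After cancelling 2 w² q against 2 w² A², the leading terms are
    -- 10 w⁶ on the left and 20 w⁶ on the right.
    F-bound : ∀ {N} → 100 ≤ w → q ≤ w * w * N + 96 * (w * cube w) → E * (2 * E + F) ≤ 2 * F * N
    -- Both sides are multiplied by w² and increased by 2 F · 96 w⁴, so that `h` applies without
    -- subtraction.
    F-bound {N} 100≤w h = ℕ.*-cancelˡ-≤ (w * w) {{ℕ.m*n≢0 w w}} (ℕ.+-cancelʳ-≤ (2 * F * (96 * (w * cube w))) _ _ (begin
      w * w * (E * (2 * E + F)) + 2 * F * (96 * (w * cube w))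
        ≡⟨ e₁ w A ⟩
      2 * (w * w) * (A * A) + w * (w * w * (5 * w + 162) * A) + w * (cube w * ((w + 38) * (3 * w + 86)) + 192 * (w * cube w) * (w + 10))
        ≤⟨ ℕ.+-monoˡ-≤ (w * (cube w * ((w + 38) * (3 * w + 86)) + 192 * (w * cube w) * (w + 10)))
             (ℕ.+-mono-≤ (ℕ.*-monoʳ-≤ (2 * (w * w)) A²≤q) (ℕ.*-monoʳ-≤ w (ℕ.*-monoʳ-≤ (w * w * (5 * w + 162)) A≤2w³))) ⟩
      2 * (w * w) * q + w * (w * w * (5 * w + 162) * (2 * cube w)) + w * (cube w * ((w + 38) * (3 * w + 86)) + 192 * (w * cube w) * (w + 10))
        ≡⟨ e₂ w q ⟩
      2 * (w * w) * q + w * (cube w * (10 * cube w + (519 * (w * w) + 2120 * w + 3268)))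
        ≤⟨ ℕ.+-monoʳ-≤ (2 * (w * w) * q) (ℕ.*-monoʳ-≤ w (ℕ.*-monoʳ-≤ (cube w) (ℕ.+-monoʳ-≤ (10 * cube w) lower-order))) ⟩
      2 * (w * w) * q + w * (cube w * (10 * cube w + 10 * cube w))
        ≡⟨ e₃ w (cube w) q ⟩
      2 * (w * w) * q + 20 * w * (cube w * cube w)
        ≤⟨ ℕ.+-monoʳ-≤ (2 * (w * w) * q) (ℕ.*-monoʳ-≤ (20 * w) w⁶≤q) ⟩
      2 * (w * w) * q + 20 * w * q
        ≡⟨ e₄ w q ⟩
      2 * F * q
        ≤⟨ ℕ.*-monoʳ-≤ (2 * F) h ⟩
      2 * F * (w * w * N + 96 * (w * cube w))
        ≡⟨ e₅ F w N (96 * (w * cube w)) ⟩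
      w * w * (2 * F * N) + 2 * F * (96 * (w * cube w)) ∎))
      where
      e₁ : ∀ w A → w * w * ((A + w * w + 38 * w) * (2 * (A + w * w + 38 * w) + (w * w + 10 * w))) + 2 * (w * w + 10 * w) * (96 * (w * (w * w * w)))
        ≡ 2 * (w * w) * (A * A) + w * (w * w * (5 * w + 162) * A) + w * (w * w * w * ((w + 38) * (3 * w + 86)) + 192 * (w * (w * w * w)) * (w + 10))
      e₁ = solve-∀
      e₂ : ∀ w q → 2 * (w * w) * q + w * (w * w * (5 * w + 162) * (2 * (w * w * w))) + w * (w * w * w * ((w + 38) * (3 * w + 86)) + 192 * (w * (w * w * w)) * (w + 10))
        ≡ 2 * (w * w) * q + w * (w * w * w * (10 * (w * w * w) + (519 * (w * w) + 2120 * w + 3268)))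
      e₂ = solve-∀
      e₃ : ∀ w c q → 2 * (w * w) * q + w * (c * (10 * c + 10 * c)) ≡ 2 * (w * w) * q + 20 * w * (c * c)
      e₃ = solve-∀
      e₄ : ∀ w q → 2 * (w * w) * q + 20 * w * q ≡ 2 * (w * w + 10 * w) * q
      e₄ = solve-∀
      e₅ : ∀ F w N x → 2 * F * (w * w * N + x) ≡ w * w * (2 * F * N) + 2 * F * x
      e₅ = solve-∀
      A≤2w³ : A ≤ 2 * cube w
      A≤2w³ = begin
        A                          ≤⟨ A≤w³ ⟩
        w * (w * w + 3 * w + 3)    ≤⟨ ℕ.*-monoʳ-≤ w small ⟩
        w * (2 * (w * w))          ≡⟨ e w ⟩
        2 * cube w                 ∎
        where
        e : ∀ w → w * (2 * (w * w)) ≡ 2 * (w * w * w)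
        e = solve-∀
        small : w * w + 3 * w + 3 ≤ 2 * (w * w)
        small = begin
          w * w + 3 * w + 3 * 1     ≤⟨ ℕ.+-monoʳ-≤ (w * w + 3 * w) (ℕ.*-monoʳ-≤ 3 1≤w) ⟩
          w * w + 3 * w + 3 * w     ≡⟨ e′ w ⟩
          w * w + 6 * w             ≤⟨ ℕ.+-monoʳ-≤ (w * w) (ℕ.*-monoˡ-≤ w (ℕ.≤-trans (ℕ.m≤m+n 6 94) 100≤w)) ⟩
          w * w + w * w             ≡⟨ e″ (w * w) ⟩
          2 * (w * w)               ∎
          where
          e′ : ∀ w → w * w + 3 * w + 3 * w ≡ w * w + 6 * w
          e′ = solve-∀
          e″ : ∀ x → x + x ≡ 2 * x
          e″ = solve-∀
      -- The 10 w³ are split as 6 + 3 + 1, one share for each term. The quadratic term is the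
      -- critical one: 519 ≤ 6 w calls for a threshold of about 100.
      lower-order : 519 * (w * w) + 2120 * w + 3268 ≤ 10 * cube w
      lower-order = begin
        519 * (w * w) + 2120 * w + 3268
          ≤⟨ ℕ.+-mono-≤ (ℕ.+-mono-≤ (ℕ.*-monoˡ-≤ (w * w) (ℕ.m≤m+n 519 81)) (ℕ.*-monoˡ-≤ w (ℕ.m≤m+n 2120 27880))) (ℕ.m≤m+n 3268 996732) ⟩
        6 * 100 * (w * w) + 3 * (100 * 100) * w + 100 * 100 * 100
          ≤⟨ ℕ.+-mono-≤ (ℕ.+-mono-≤ (ℕ.*-monoˡ-≤ (w * w) (ℕ.*-monoʳ-≤ 6 100≤w))
               (ℕ.*-monoˡ-≤ w (ℕ.*-monoʳ-≤ 3 (ℕ.*-mono-≤ 100≤w 100≤w)))) (ℕ.*-mono-≤ (ℕ.*-mono-≤ 100≤w 100≤w) 100≤w) ⟩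
        6 * w * (w * w) + 3 * (w * w) * w + w * w * w
          ≡⟨ e w ⟩
        10 * cube w ∎
        where
        e : ∀ w → 6 * w * (w * w) + 3 * (w * w) * w + w * w * w ≡ 10 * (w * w * w)
        e = solve-∀

  floor-√ : ∀ q → ∃ λ A → A * A ≤ q × q < suc A * suc A
  floor-√ q with A , A²≤q , ¬≤q ← greatest (λ A → A * A ℕ.≤? q) z≤n (suc q)
                   (ℕ.<⇒≱ (ℕ.<-≤-trans (ℕ.n<1+n q) (ℕ.m≤m*n (suc q) (suc q)))) = A , A²≤q , ℕ.≰⇒> ¬≤q

  m≤cube : ∀ m .{{_ : NonZero m}} → m ≤ cube m
  m≤cube m = ℕ.≤-trans (ℕ.m≤m*n m m) (ℕ.m≤m*n (m * m) m)

  floor-⁶√ : ∀ q → ∃ λ w → cube w * cube w ≤ q × q < cube (suc w) * cube (suc w)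
  floor-⁶√ q with w , w⁶≤q , ¬≤q ← greatest (λ w → cube w * cube w ℕ.≤? q) z≤n (suc q)
                   (ℕ.<⇒≱ (ℕ.<-≤-trans (ℕ.n<1+n q) (ℕ.≤-trans (m≤cube (suc q)) (ℕ.m≤m*n (cube (suc q)) (cube (suc q)))))) =
    w , w⁶≤q , ℕ.≰⇒> ¬≤q

  cube-mono : ∀ {m n} → m ≤ n → cube m ≤ cube n
  cube-mono m≤n = ℕ.*-mono-≤ (ℕ.*-mono-≤ m≤n m≤n) m≤n

  ≤1+2*half : ∀ r → r ≤ suc (r / 2 + r / 2)
  ≤1+2*half r = begin
    r                    ≡⟨ m≡m%n+[m/n]*n r 2 ⟩
    r % 2 + r / 2 * 2    ≤⟨ ℕ.+-monoˡ-≤ (r / 2 * 2) (ℕ.s≤s⁻¹ (m%n<n r 2)) ⟩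
    1 + r / 2 * 2        ≡⟨ e (r / 2) ⟩
    suc (r / 2 + r / 2)  ∎
    where
    open ℕ.≤-Reasoning
    e : ∀ s → 1 + s * 2 ≡ suc (s + s)
    e = solve-∀

  half²≤#cells : ∀ r → r / 2 * (r / 2) ≤ #cells r
  half²≤#cells r = ²≤#cells {r / 2} {r} (ℕ.≤-trans (ℕ.≤-reflexive (e (r / 2))) (m/n*n≤m r 2))
    where
    e : ∀ s → s + s ≡ s * 2
    e = solve-∀

  module _ {r m} .{{_ : NonZero r}} (dd : DD m r) A w
    (A²≤q : A * A ≤ #cells r) (q<A² : #cells r < suc A * suc A)
    (w⁶≤q : cube w * cube w ≤ #cells r) (q<w⁶ : #cells r < cube (suc w) * cube (suc w)) where

    open ℕ.≤-Reasoning

    -- The coefficient 86 is 2 · 38 + 10, from the linear terms of `E` and `F`.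
    dots-bound-large : 100 ≤ w → 2 * m ≤ 2 * A + 3 * (w * w) + 86 * w
    dots-bound-large 100≤w = begin
      2 * m                                               ≤⟨ quadratic-bound {m} {N} {S} {E} {F} {{N≢0}} covering S≤E² E-F ⟩
      2 * (A + w * w + 38 * w) + (w * w + 10 * w)         ≡⟨ e A w ⟩
      2 * A + 3 * (w * w) + 86 * w                        ∎
      where
      e : ∀ A w → 2 * (A + w * w + 38 * w) + (w * w + 10 * w) ≡ 2 * A + 3 * (w * w) + 86 * w
      e = solve-∀
      1≤w : 1 ≤ w
      1≤w = ℕ.≤-trans (ℕ.m≤m+n 1 99) 100≤w
      instance
        w≢0 : NonZero w
        w≢0 = ℕ.>-nonZero 1≤w
        2w≢0 : NonZero (2 * w)
        2w≢0 = ℕ.m*n≢0 2 w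
      1≤A : 1 ≤ A
      1≤A = ℕ.≤-trans (cube-mono 1≤w) (ℕ.s≤s⁻¹ (²-cancel-< {cube w} {suc A} (ℕ.≤-<-trans w⁶≤q q<A²)))
      instance
        A≢0 : NonZero A
        A≢0 = ℕ.>-nonZero 1≤A
      A≤r : A ≤ r
      A≤r = ²-cancel-≤ (ℕ.≤-trans A²≤q (#cells≤² r))
      half≤A : r / 2 ≤ A
      half≤A = ℕ.s≤s⁻¹ (²-cancel-< {r / 2} {suc A} (ℕ.≤-<-trans (half²≤#cells r) q<A²))
      r≤3A : r ≤ 3 * A
      r≤3A = begin
        r                   ≤⟨ ≤1+2*half r ⟩
        1 + (r / 2 + r / 2) ≤⟨ ℕ.+-mono-≤ 1≤A (ℕ.+-mono-≤ half≤A half≤A) ⟩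
        A + (A + A)         ≡⟨ e′ A ⟩
        3 * A               ∎
        where
        e′ : ∀ A → A + (A + A) ≡ 3 * A
        e′ = solve-∀
      -- Rounded up, because the lower bound on `N` needs r ≤ 2 w R; the excess is at most 2 w.
      R = suc (r / (2 * w))
      2wR : 2 * w * R ≡ r / (2 * w) * (2 * w) + 2 * w
      2wR = e′ (2 * w) (r / (2 * w))
        where
        e′ : ∀ n k → n * suc k ≡ k * n + n
        e′ = solve-∀
      2wR≤ : 2 * w * R ≤ r + 2 * w
      2wR≤ = ℕ.≤-trans (ℕ.≤-reflexive 2wR) (ℕ.+-monoˡ-≤ (2 * w) (m/n*n≤m r (2 * w)))
      r≤2wR : r ≤ 2 * w * R
      r≤2wR = begin
        r                                           ≡⟨ m≡m%n+[m/n]*n r (2 * w) ⟩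
        r % (2 * w) + r / (2 * w) * (2 * w)         ≤⟨ ℕ.+-monoˡ-≤ _ (ℕ.<⇒≤ (m%n<n r (2 * w))) ⟩
        2 * w + r / (2 * w) * (2 * w)               ≡⟨ ℕ.+-comm (2 * w) _ ⟩
        r / (2 * w) * (2 * w) + 2 * w               ≡⟨ 2wR ⟨
        2 * w * R                                   ∎
      open Estimates {#cells r} {r} {w} {A} {R} A²≤q q<A² w⁶≤q q<w⁶ A≤r r≤3A r≤2wR 2wR≤ hiding (1≤w; 1≤A)
      S N : ℕ
      S = #quarter D
      N = 4 * #cells R
      S≤E² : S ≤ E * E
      S≤E² = S-bound (begin
        r * r * S                                       ≤⟨ ℕ.*-monoʳ-≤ (r * r) (#quarter≤#cells+axes D) ⟩
        r * r * (#cells D + (D + suc D))                ≡⟨ ℕ.*-distribˡ-+ (r * r) (#cells D) _ ⟩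
        r * r * #cells D + r * r * (D + suc D)          ≤⟨ ℕ.+-monoˡ-≤ _ (#cells≤#quarter-scaled D r {{D≢0}}) ⟩
        D * D * #quarter r + r * r * (D + suc D)        ≤⟨ ℕ.+-monoˡ-≤ _ (ℕ.*-monoʳ-≤ (D * D) (#quarter≤#cells+axes r)) ⟩
        D * D * (#cells r + (r + suc r)) + r * r * (D + suc D) ∎)
        where
        D≢0 : NonZero D
        D≢0 = ℕ.>-nonZero (ℕ.≤-trans (ℕ.>-nonZero⁻¹ r) (ℕ.m≤m+n r (R + R)))
      q≤ : #cells r ≤ w * w * N + 96 * (w * cube w)
      q≤ = N-bound (begin
        4 * (R * R * #cells r)                          ≤⟨ ℕ.*-monoʳ-≤ 4 (#cells≤#quarter-scaled r R) ⟩
        4 * (r * r * #quarter R)                        ≤⟨ ℕ.*-monoʳ-≤ 4 (ℕ.*-monoʳ-≤ (r * r) (#quarter≤#cells+axes R)) ⟩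
        4 * (r * r * (#cells R + (R + suc R)))          ≡⟨ e′ r (#cells R) R ⟩
        r * r * (4 * #cells R + (8 * R + 4))            ∎)
        where
        e′ : ∀ r n R → 4 * (r * r * (n + (R + suc R))) ≡ r * r * (4 * n + (8 * R + 4))
        e′ = solve-∀
      E-F : E * (2 * E + F) ≤ 2 * F * N
      E-F = F-bound 100≤w q≤
      -- With N = 0 the inequality `E-F` would bound a positive product by 0.
      N≢0 : NonZero N
      N≢0 = ℕ.≢-nonZero λ N≡0 → ℕ.<⇒≱ (ℕ.*-mono-≤ 1≤E (ℕ.≤-trans 1≤E (ℕ.≤-trans (ℕ.m≤m+n E _) (ℕ.m≤m+n (2 * E) F))))
        (ℕ.≤-trans E-F (ℕ.≤-reflexive (trans (cong (2 * F *_) N≡0) (ℕ.*-zeroʳ (2 * F)))))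
        where
        1≤E : 1 ≤ E
        1≤E = ℕ.≤-trans 1≤A (ℕ.≤-trans (ℕ.m≤m+n A (w * w)) (ℕ.m≤m+n _ (38 * w)))
      covering : m * m * N ≤ S * (m + N)
      covering = ℕ.*-cancelˡ-≤ N {{N≢0}} (begin
        N * (m * m * N)         ≡⟨ e₁ m N ⟩
        m * N * (m * N)         ≤⟨ subst (λ n → m * n * (m * n) ≤ S * (m * n + n * n)) (length-offAxisDisc R) (Covering.covering-bound dd R) ⟩
        S * (m * N + N * N)     ≡⟨ e₂ S m N ⟩
        N * (S * (m + N))       ∎)
        where
        e₁ : ∀ m N → N * (m * m * N) ≡ m * N * (m * N)
        e₁ = solve-∀
        e₂ : ∀ S m N → S * (m * N + N * N) ≡ N * (S * (m + N))
        e₂ = solve-∀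

    -- A bounded `w` bounds q, then `r`, since q is at least the square of `r / 2`, and finally `m`.
    dots-bound-small : ∀ {T} → w < T → m ≤ cube T * cube T + (suc (cube T + cube T) + suc (suc (cube T + cube T)))
    dots-bound-small {T} w<T = begin
      m                                ≤⟨ dots≤#quarter dd ⟩
      #quarter r                       ≤⟨ #quarter≤#cells+axes r ⟩
      #cells r + (r + suc r)           ≤⟨ ℕ.+-mono-≤ (ℕ.<⇒≤ q<T⁶) (ℕ.+-mono-≤ r≤ (s≤s r≤)) ⟩
      cube T * cube T + (suc (cube T + cube T) + suc (suc (cube T + cube T))) ∎
      where
      q<T⁶ : #cells r < cube T * cube T
      q<T⁶ = ℕ.<-≤-trans q<w⁶ (ℕ.*-mono-≤ (cube-mono w<T) (cube-mono w<T))
      half≤ : r / 2 ≤ cube T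
      half≤ = ℕ.<⇒≤ (²-cancel-< {r / 2} {cube T} (ℕ.≤-<-trans (half²≤#cells r) q<T⁶))
      r≤ : r ≤ suc (cube T + cube T)
      r≤ = ℕ.≤-trans (≤1+2*half r) (s≤s (ℕ.+-mono-≤ half≤ half≤))

  abstract
    smallBound : ℕ
    smallBound = cube 100 * cube 100 + (suc (cube 100 + cube 100) + suc (suc (cube 100 + cube 100)))

    dots-bound : ∀ {r m} .{{_ : NonZero r}} → DD m r → ∃ λ A → ∃ λ w →
      A * A ≤ #cells r × cube w * cube w ≤ #cells r ×
      2 * m ≤ 2 * A + 3 * (w * w) + 86 * w + 2 * smallBound
    dots-bound {r} {m} dd
      with A , A²≤q , q<A² ← floor-√ (#cells r) | w , w⁶≤q , q<w⁶ ← floor-⁶√ (#cells r) =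
      A , w , A²≤q , w⁶≤q , bound
      where
      bound : 2 * m ≤ 2 * A + 3 * (w * w) + 86 * w + 2 * smallBound
      bound with 100 ℕ.≤? w
      ... | yes 100≤w = ℕ.≤-trans (dots-bound-large dd A w A²≤q q<A² w⁶≤q q<w⁶ 100≤w) (ℕ.m≤m+n (2 * A + 3 * (w * w) + 86 * w) (2 * smallBound))
      ... | no  100≰w = ℕ.≤-trans (ℕ.*-monoʳ-≤ 2 (dots-bound-small dd A w A²≤q q<A² w⁶≤q q<w⁶ (ℕ.≰⇒> 100≰w)))
                          (ℕ.m≤n+m (2 * smallBound) (2 * A + 3 * (w * w) + 86 * w))

open Lattice

open import Data.Rational as ℚ using (ℚ; 0ℚ; 1ℚ; mkℚ; _+_; _*_; _-_; -_; _/_; _≤_; _<_)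
import Data.Rational.Properties as ℚ
open import Data.Rational.Unnormalised as ℚᵘ using (mkℚᵘ; *≡*; *≤*)
import Data.Rational.Unnormalised.Properties as ℚᵘ

-- Rational arithmetic

ℚ-ring : AlmostCommutativeRing 0ℓ 0ℓ
ℚ-ring = fromCommutativeRing ℚ.+-*-commutativeRing λ p → dec⇒maybe (0ℚ ℚ.≟ p)

toℚᵘ-ℕtoℚ : ∀ n → ℚ.toℚᵘ (ℕtoℚ n) ℚᵘ.≃ mkℚᵘ (+ n) 0
toℚᵘ-ℕtoℚ n = ℚ.toℚᵘ-fromℚᵘ (mkℚᵘ (+ n) 0)

ℕtoℚ-+ : ∀ m n → ℕtoℚ (m ℕ.+ n) ≡ ℕtoℚ m + ℕtoℚ n
ℕtoℚ-+ m n = ℚ.toℚᵘ-injective (begin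
  ℚ.toℚᵘ (ℕtoℚ (m ℕ.+ n))                 ≈⟨ toℚᵘ-ℕtoℚ (m ℕ.+ n) ⟩
  mkℚᵘ (+ (m ℕ.+ n)) 0                    ≈⟨ *≡* (cong (ℤ._* + 1) (cong₂ ℤ._+_ (sym (ℤ.*-identityʳ (+ m))) (sym (ℤ.*-identityʳ (+ n))))) ⟩
  mkℚᵘ (+ m) 0 ℚᵘ.+ mkℚᵘ (+ n) 0          ≈⟨ ℚᵘ.+-cong (toℚᵘ-ℕtoℚ m) (toℚᵘ-ℕtoℚ n) ⟨
  ℚ.toℚᵘ (ℕtoℚ m) ℚᵘ.+ ℚ.toℚᵘ (ℕtoℚ n)    ≈⟨ ℚ.toℚᵘ-homo-+ (ℕtoℚ m) (ℕtoℚ n) ⟨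
  ℚ.toℚᵘ (ℕtoℚ m + ℕtoℚ n)              ∎)
  where open ℚᵘ.≃-Reasoning

ℕtoℚ-* : ∀ m n → ℕtoℚ (m ℕ.* n) ≡ ℕtoℚ m * ℕtoℚ n
ℕtoℚ-* m n = ℚ.toℚᵘ-injective (begin
  ℚ.toℚᵘ (ℕtoℚ (m ℕ.* n))                 ≈⟨ toℚᵘ-ℕtoℚ (m ℕ.* n) ⟩
  mkℚᵘ (+ (m ℕ.* n)) 0                    ≈⟨ *≡* (cong (ℤ._* + 1) (ℤ.pos-* m n)) ⟩
  mkℚᵘ (+ m) 0 ℚᵘ.* mkℚᵘ (+ n) 0          ≈⟨ ℚᵘ.*-cong (toℚᵘ-ℕtoℚ m) (toℚᵘ-ℕtoℚ n) ⟨
  ℚ.toℚᵘ (ℕtoℚ m) ℚᵘ.* ℚ.toℚᵘ (ℕtoℚ n)    ≈⟨ ℚ.toℚᵘ-homo-* (ℕtoℚ m) (ℕtoℚ n) ⟨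
  ℚ.toℚᵘ (ℕtoℚ m * ℕtoℚ n)              ∎)
  where open ℚᵘ.≃-Reasoning

ℕtoℚ-mono-≤ : ∀ {m n} → m ℕ.≤ n → ℕtoℚ m ≤ ℕtoℚ n
ℕtoℚ-mono-≤ {m} {n} m≤n = ℚ.toℚᵘ-cancel-≤ (begin
  ℚ.toℚᵘ (ℕtoℚ m) ≃⟨ toℚᵘ-ℕtoℚ m ⟩
  mkℚᵘ (+ m) 0    ≤⟨ *≤* (ℤ.*-monoʳ-≤-nonNeg (+ 1) (ℤ.+≤+ m≤n)) ⟩
  mkℚᵘ (+ n) 0    ≃⟨ toℚᵘ-ℕtoℚ n ⟨
  ℚ.toℚᵘ (ℕtoℚ n) ∎)
  where open ℚᵘ.≤-Reasoning

0≤ℕtoℚ : ∀ n → 0ℚ ≤ ℕtoℚ n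
0≤ℕtoℚ n = ℕtoℚ-mono-≤ {0} {n} z≤n

ℕtoℚ-/-* : ∀ n d .{{_ : NonZero d}} → + n / d * ℕtoℚ d ≡ ℕtoℚ n
ℕtoℚ-/-* n d@(suc d-1) = ℚ.toℚᵘ-injective (begin
  ℚ.toℚᵘ (+ n / d * ℕtoℚ d)                ≈⟨ ℚ.toℚᵘ-homo-* (+ n / d) (ℕtoℚ d) ⟩
  ℚ.toℚᵘ (+ n / d) ℚᵘ.* ℚ.toℚᵘ (ℕtoℚ d)      ≈⟨ ℚᵘ.*-cong (ℚ.toℚᵘ-fromℚᵘ (mkℚᵘ (+ n) d-1)) (toℚᵘ-ℕtoℚ d) ⟩
  mkℚᵘ (+ n) d-1 ℚᵘ.* mkℚᵘ (+ d) 0             ≈⟨ *≡* (trans (ℤ.*-identityʳ _) (cong (λ k → + n ℤ.* + k) (sym (ℕ.*-identityʳ d)))) ⟩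
  mkℚᵘ (+ n) 0                                 ≈⟨ toℚᵘ-ℕtoℚ n ⟨
  ℚ.toℚᵘ (ℕtoℚ n)                              ∎)
  where open ℚᵘ.≃-Reasoning

abstract
  -- An opaque copy of `ℕtoℚ`, used only through the laws below; `ℕtoℚ` itself would unfold to the
  -- reduction of fractions to lowest terms.
  ι : ℕ → ℚ
  ι = ℕtoℚ

  ι≡ℕtoℚ : ∀ n → ι n ≡ ℕtoℚ n
  ι≡ℕtoℚ n = refl

  ι-0 : ι 0 ≡ 0ℚ
  ι-0 = refl

  ι-1 : ι 1 ≡ 1ℚ
  ι-1 = refl

  ι-+ : ∀ m n → ι (m ℕ.+ n) ≡ ι m + ι n
  ι-+ = ℕtoℚ-+

  ι-* : ∀ m n → ι (m ℕ.* n) ≡ ι m * ι n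
  ι-* = ℕtoℚ-*

  ι-mono-≤ : ∀ {m n} → m ℕ.≤ n → ι m ≤ ι n
  ι-mono-≤ = ℕtoℚ-mono-≤

  ι-cancel-≤ : ∀ {m n} → ι m ≤ ι n → m ℕ.≤ n
  ι-cancel-≤ {m} {n} h = ℤ.drop‿+≤+ (subst₂ ℤ._≤_ (ℤ.*-identityʳ (+ m)) (ℤ.*-identityʳ (+ n)) (ℚᵘ.drop-*≤* (begin
    mkℚᵘ (+ m) 0    ≃⟨ toℚᵘ-ℕtoℚ m ⟨
    ℚ.toℚᵘ (ℕtoℚ m) ≤⟨ ℚ.toℚᵘ-mono-≤ h ⟩
    ℚ.toℚᵘ (ℕtoℚ n) ≃⟨ toℚᵘ-ℕtoℚ n ⟩
    mkℚᵘ (+ n) 0    ∎)))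
    where open ℚᵘ.≤-Reasoning

  0≤ι : ∀ n → 0ℚ ≤ ι n
  0≤ι = 0≤ℕtoℚ

  ι-/-* : ∀ n d .{{_ : NonZero d}} → + n / d * ι d ≡ ι n
  ι-/-* = ℕtoℚ-/-*

ι-suc : ∀ n → ι (suc n) ≡ 1ℚ + ι n
ι-suc n = trans (ι-+ 1 n) (cong (_+ ι n) ι-1)

0≤/ : ∀ n d .{{_ : NonZero d}} → 0ℚ ≤ + n / d
0≤/ n d = ℚ.nonNegative⁻¹ (+ n / d) {{ℚ.normalize-nonNeg n d}}

*-monoˡ-≤ : ∀ {r p q} → 0ℚ ≤ r → p ≤ q → r * p ≤ r * q
*-monoˡ-≤ {r} 0≤r = ℚ.*-monoˡ-≤-nonNeg r {{ℚ.nonNegative 0≤r}}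

*-monoʳ-≤ : ∀ {r p q} → 0ℚ ≤ r → p ≤ q → p * r ≤ q * r
*-monoʳ-≤ {r} 0≤r = ℚ.*-monoʳ-≤-nonNeg r {{ℚ.nonNegative 0≤r}}

0≤-* : ∀ {p q} → 0ℚ ≤ p → 0ℚ ≤ q → 0ℚ ≤ p * q
0≤-* {p} {q} 0≤p 0≤q = subst (_≤ p * q) (ℚ.*-zeroʳ p) (*-monoˡ-≤ 0≤p 0≤q)

0≤-+ : ∀ {p q} → 0ℚ ≤ p → 0ℚ ≤ q → 0ℚ ≤ p + q
0≤-+ = ℚ.+-mono-≤

+-excess : ∀ {p q d} → 0ℚ ≤ d → p + d ≡ q → p ≤ q
+-excess {p} {d = d} 0≤d eq = subst₂ _≤_ (ℚ.+-identityʳ p) eq (ℚ.+-monoʳ-≤ p 0≤d)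

p≤q⇒0≤q-p : ∀ {p q} → p ≤ q → 0ℚ ≤ q - p
p≤q⇒0≤q-p {p} {q} p≤q = subst (_≤ q - p) (ℚ.+-inverseʳ p) (ℚ.+-monoˡ-≤ (- p) p≤q)

*-mono-≤ : ∀ {p q r s} → 0ℚ ≤ p → p ≤ q → 0ℚ ≤ r → r ≤ s → p * r ≤ q * s
*-mono-≤ 0≤p p≤q 0≤r r≤s = ℚ.≤-trans (*-monoʳ-≤ 0≤r p≤q) (*-monoˡ-≤ (ℚ.≤-trans 0≤p p≤q) r≤s)

infixr 8 _^_
_^_ : ℚ → ℕ → ℚ
t ^ zero  = 1ℚ
t ^ suc k = t * t ^ k

1^ : ∀ k → 1ℚ ^ k ≡ 1ℚ
1^ zero    = refl
1^ (suc k) = trans (ℚ.*-identityˡ (1ℚ ^ k)) (1^ k)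

0≤^ : ∀ {t} → 0ℚ ≤ t → ∀ k → 0ℚ ≤ t ^ k
0≤^ 0≤t zero    = 0≤ℕtoℚ 1
0≤^ 0≤t (suc k) = 0≤-* 0≤t (0≤^ 0≤t k)

module _ {s t : ℚ} (0≤s : 0ℚ ≤ s) (s≤t : s ≤ t) where
  private
    h = t - s
    0≤h : 0ℚ ≤ h
    0≤h = p≤q⇒0≤q-p s≤t
    0≤t : 0ℚ ≤ t
    0≤t = ℚ.≤-trans 0≤s s≤t

  ^-mono : ∀ k → s ^ k ≤ t ^ k
  ^-mono zero    = ℚ.≤-refl
  ^-mono (suc k) = *-mono-≤ 0≤s s≤t (0≤^ 0≤s k) (^-mono k)

  -- With `^-slope-≥` this replaces the mean value theorem for powers: the chord slope lies between
  -- the derivatives at the two ends. The difference t T - s S is split as t (T - S) + S (t - s)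
  -- here and as s (T - S) + T (t - s) there.
  ^-slope-≤ : ∀ k → t ^ suc k - s ^ suc k ≤ ι (suc k) * (t ^ k * h)
  ^-slope-≤ zero = ℚ.≤-reflexive (trans (eq t s) (cong (_* (1ℚ * h)) (sym ι-1)))
    where
    eq : ∀ t s → t * 1ℚ - s * 1ℚ ≡ 1ℚ * (1ℚ * (t - s))
    eq = RingSolver.solve-∀ ℚ-ring
  ^-slope-≤ (suc k) = begin
    t ^ suc (suc k) - s ^ suc (suc k)
      ≡⟨ split t s (t ^ suc k) (s ^ suc k) ⟩
    t * (t ^ suc k - s ^ suc k) + s ^ suc k * h
      ≤⟨ ℚ.+-mono-≤ (*-monoˡ-≤ 0≤t (^-slope-≤ k)) (*-monoʳ-≤ 0≤h (^-mono (suc k))) ⟩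
    t * (ι (suc k) * (t ^ k * h)) + t ^ suc k * h
      ≡⟨ collect t (ι (suc k)) (t ^ k) h ⟩
    (1ℚ + ι (suc k)) * (t ^ suc k * h)
      ≡⟨ cong (_* (t ^ suc k * h)) (ι-suc (suc k)) ⟨
    ι (suc (suc k)) * (t ^ suc k * h) ∎
    where
    open ℚ.≤-Reasoning
    split : ∀ t s T S → t * T - s * S ≡ t * (T - S) + S * (t - s)
    split = RingSolver.solve-∀ ℚ-ring
    collect : ∀ t n T h → t * (n * (T * h)) + t * T * h ≡ (1ℚ + n) * (t * T * h)
    collect = RingSolver.solve-∀ ℚ-ring

  ^-slope-≥ : ∀ k → ι (suc k) * (s ^ k * h) ≤ t ^ suc k - s ^ suc k
  ^-slope-≥ zero = ℚ.≤-reflexive (trans (cong (_* (1ℚ * h)) ι-1) (eq t s))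
    where
    eq : ∀ t s → 1ℚ * (1ℚ * (t - s)) ≡ t * 1ℚ - s * 1ℚ
    eq = RingSolver.solve-∀ ℚ-ring
  ^-slope-≥ (suc k) = begin
    ι (suc (suc k)) * (s ^ suc k * h)
      ≡⟨ cong (_* (s ^ suc k * h)) (ι-suc (suc k)) ⟩
    (1ℚ + ι (suc k)) * (s ^ suc k * h)
      ≡⟨ collect s (ι (suc k)) (s ^ k) h ⟨
    s * (ι (suc k) * (s ^ k * h)) + s ^ suc k * h
      ≤⟨ ℚ.+-mono-≤ (*-monoˡ-≤ 0≤s (^-slope-≥ k)) (*-monoʳ-≤ 0≤h (^-mono (suc k))) ⟩
    s * (t ^ suc k - s ^ suc k) + t ^ suc k * h
      ≡⟨ split t s (t ^ suc k) (s ^ suc k) ⟨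
    t ^ suc (suc k) - s ^ suc (suc k) ∎
    where
    open ℚ.≤-Reasoning
    split : ∀ t s T S → t * T - s * S ≡ s * (T - S) + T * (t - s)
    split = RingSolver.solve-∀ ℚ-ring
    collect : ∀ t n T h → t * (n * (T * h)) + t * T * h ≡ (1ℚ + n) * (t * T * h)
    collect = RingSolver.solve-∀ ℚ-ring

  ^-lipschitz : t ≤ 1ℚ → ∀ k → t ^ k - s ^ k ≤ ι k * h
  ^-lipschitz t≤1 zero    = ℚ.≤-reflexive (sym (trans (cong (_* h) ι-0) (ℚ.*-zeroˡ h)))
  ^-lipschitz t≤1 (suc k) = begin
    t ^ suc k - s ^ suc k       ≤⟨ ^-slope-≤ k ⟩
    ι (suc k) * (t ^ k * h)     ≤⟨ *-monoˡ-≤ (0≤ι (suc k)) (*-monoʳ-≤ 0≤h (^≤1 k)) ⟩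
    ι (suc k) * (1ℚ * h)        ≡⟨ cong (ι (suc k) *_) (ℚ.*-identityˡ h) ⟩
    ι (suc k) * h               ∎
    where
    open ℚ.≤-Reasoning
    ^≤1 : ∀ k → t ^ k ≤ 1ℚ
    ^≤1 zero    = ℚ.≤-refl
    ^≤1 (suc k) = subst (t ^ suc k ≤_) (ℚ.*-identityˡ 1ℚ) (*-mono-≤ 0≤t t≤1 (0≤^ 0≤t k) (^≤1 k))

-- The arctangent series

sgn : ℕ → ℤ
sgn zero          = + 4
sgn (suc zero)    = ℤ.- (+ 4)
sgn (suc (suc k)) = sgn k

sgn-unique : (f : ℕ → ℤ) → f 0 ≡ + 4 → f 1 ≡ ℤ.- (+ 4) → (∀ k → f (suc (suc k)) ≡ f k) → ∀ k → f k ≡ sgn k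
sgn-unique f f0 f1 f2 zero          = f0
sgn-unique f f0 f1 f2 (suc zero)    = f1
sgn-unique f f0 f1 f2 (suc (suc k)) = trans (f2 k) (sgn-unique f f0 f1 f2 k)

-- The sign function local to leibniz has no name outside Defs and takes the
-- argument of leibniz as a hidden parameter; unification recovers it once that
-- parameter and the division are abstracted to variables.
mutual
  leibnizSgn : ℕ → ℕ → ℤ
  leibnizSgn = _

  leibniz-suc-suc-suc : ∀ k → leibniz (suc (suc (suc k))) ≡
    leibniz (suc (suc k)) + leibnizSgn (suc (suc k)) k / suc (2 ℕ.* suc (suc k))
  leibniz-suc-suc-suc k with suc (suc k) | _/_
  ... | _ | _ = refl

leibniz-suc : ∀ k → leibniz (suc k) ≡ leibniz k + sgn k / suc (2 ℕ.* k)
leibniz-suc zero          = refl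
leibniz-suc (suc zero)    = refl
leibniz-suc (suc (suc k)) = trans (leibniz-suc-suc-suc k)
  (cong (λ z → leibniz (suc (suc k)) + z / suc (2 ℕ.* suc (suc k)))
    (sgn-unique (leibnizSgn (suc (suc k))) refl refl (λ _ → refl) k))

sgn-even : ∀ n → sgn (2 ℕ.* n) ≡ + 4
sgn-even zero    = refl
sgn-even (suc n) = trans (cong sgn (ℕ.*-suc 2 n)) (sgn-even n)

sgn-odd : ∀ n → sgn (suc (2 ℕ.* n)) ≡ ℤ.- (+ 4)
sgn-odd zero    = refl
sgn-odd (suc n) = trans (cong (λ k → sgn (suc k)) (ℕ.*-suc 2 n)) (sgn-odd n)

-- The number 4 n + 2 from the geometric sum 1 - t² + ... + t^(4n) = (1 + t^(4n+2)) / (1 + t²).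
exponent : ℕ → ℕ
exponent zero    = 2
exponent (suc n) = 4 ℕ.+ exponent n

-- The odd Taylor polynomials of 4 arctan; their derivative is
-- 4 (1 + t ^ exponent n) / (1 + t²).
arctan4 : ℕ → ℚ → ℚ
arctan4 zero    t = ι 4 * t
arctan4 (suc n) t = arctan4 n t - + 4 / suc e * t ^ suc e + + 4 / suc (2 ℕ.+ e) * t ^ suc (2 ℕ.+ e)
  where e = exponent n

arctan4-0 : ∀ n → arctan4 n 0ℚ ≡ 0ℚ
arctan4-0 zero    = ℚ.*-zeroʳ (ι 4)
arctan4-0 (suc n) = cong₂ _+_ (cong₂ _-_ (arctan4-0 n) (vanish (exponent n))) (vanish (2 ℕ.+ exponent n))
  where
  vanish : ∀ e → + 4 / suc e * 0ℚ ^ suc e ≡ 0ℚ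
  vanish e = trans (cong (+ 4 / suc e *_) (ℚ.*-zeroˡ (0ℚ ^ e))) (ℚ.*-zeroʳ (+ 4 / suc e))

exponent-odd : ∀ n → 2 ℕ.* suc (2 ℕ.* n) ≡ exponent n
exponent-odd zero    = refl
exponent-odd (suc n) = trans (shift n) (cong (4 ℕ.+_) (exponent-odd n))
  where
  shift : ∀ n → 2 ℕ.* suc (2 ℕ.* suc n) ≡ 4 ℕ.+ 2 ℕ.* suc (2 ℕ.* n)
  shift = solve-∀

arctan4-1 : ∀ n → arctan4 n 1ℚ ≡ leibniz (suc (2 ℕ.* n))
arctan4-1 zero    = trans (ℚ.*-identityʳ (ι 4)) (ι≡ℕtoℚ 4)
arctan4-1 (suc n) = begin
  arctan4 n 1ℚ - + 4 / suc e * 1ℚ ^ suc e + + 4 / suc (2 ℕ.+ e) * 1ℚ ^ suc (2 ℕ.+ e)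
    ≡⟨ cong₂ _+_ (cong₂ _-_ (arctan4-1 n) (unit e)) (unit (2 ℕ.+ e)) ⟩
  leibniz k + (ℤ.- (+ 4)) / suc e + + 4 / suc (2 ℕ.+ e)
    ≡⟨ cong₂ (λ x y → leibniz k + x + y) (second (sgn-odd n) (exponent-odd n)) (second (sgn-even n) (trans (ℕ.*-suc 2 k) (cong (2 ℕ.+_) (exponent-odd n)))) ⟨
  leibniz k + sgn k / suc (2 ℕ.* k) + sgn (suc k) / suc (2 ℕ.* suc k)
    ≡⟨ cong (_+ sgn (suc k) / suc (2 ℕ.* suc k)) (leibniz-suc k) ⟨
  leibniz (suc k) + sgn (suc k) / suc (2 ℕ.* suc k)
    ≡⟨ leibniz-suc (suc k) ⟨
  leibniz (suc (suc k))
    ≡⟨ cong (λ j → leibniz (suc j)) (ℕ.*-suc 2 n) ⟨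
  leibniz (suc (2 ℕ.* suc n)) ∎
  where
  open ≡-Reasoning
  e = exponent n
  k = suc (2 ℕ.* n)
  unit : ∀ e → + 4 / suc e * 1ℚ ^ suc e ≡ + 4 / suc e
  unit e = trans (cong (+ 4 / suc e *_) (1^ (suc e))) (ℚ.*-identityʳ (+ 4 / suc e))
  second : ∀ {z z′ d d′} → z ≡ z′ → d ≡ d′ → z / suc d ≡ z′ / suc d′
  second refl refl = refl

-- Coefficient of h² in the error of one Riemann step. At each stage, with e = `exponent n`,
-- replacing t^e by s^e costs at most 4 e h² (1 + s²) ≤ 8 e h².
curvature : ℕ → ℕ
curvature zero    = 0
curvature (suc n) = curvature n ℕ.+ (4 ℕ.* exponent n ℕ.+ 4 ℕ.* exponent n)

module _ {s t : ℚ} (0≤s : 0ℚ ≤ s) (s≤t : s ≤ t) (t≤1 : t ≤ 1ℚ) where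

  private
    h = t - s

  0≤h : 0ℚ ≤ h
  0≤h = p≤q⇒0≤q-p s≤t

  s²≤1 : s * s ≤ 1ℚ
  s²≤1 = subst (s * s ≤_) (ℚ.*-identityˡ 1ℚ) (*-mono-≤ 0≤s (ℚ.≤-trans s≤t t≤1) 0≤s (ℚ.≤-trans s≤t t≤1))

  private
    0≤1+s² : 0ℚ ≤ 1ℚ + s * s
    0≤1+s² = 0≤-+ (0≤ℕtoℚ 1) (0≤-* 0≤s 0≤s)

  term-≤ : ∀ e → + 4 / suc e * (t ^ suc e - s ^ suc e) ≤ ι 4 * (t ^ e * h)
  term-≤ e = begin
    + 4 / suc e * (t ^ suc e - s ^ suc e)     ≤⟨ *-monoˡ-≤ (0≤/ 4 (suc e)) (^-slope-≤ 0≤s s≤t e) ⟩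
    + 4 / suc e * (ι (suc e) * (t ^ e * h))   ≡⟨ ℚ.*-assoc (+ 4 / suc e) (ι (suc e)) _ ⟨
    + 4 / suc e * ι (suc e) * (t ^ e * h)     ≡⟨ cong (_* (t ^ e * h)) (ι-/-* 4 (suc e)) ⟩
    ι 4 * (t ^ e * h)                         ∎
    where open ℚ.≤-Reasoning

  term-≥ : ∀ e → ι 4 * (s ^ e * h) ≤ + 4 / suc e * (t ^ suc e - s ^ suc e)
  term-≥ e = begin
    ι 4 * (s ^ e * h)                         ≡⟨ cong (_* (s ^ e * h)) (ι-/-* 4 (suc e)) ⟨
    + 4 / suc e * ι (suc e) * (s ^ e * h)     ≡⟨ ℚ.*-assoc (+ 4 / suc e) (ι (suc e)) _ ⟩
    + 4 / suc e * (ι (suc e) * (s ^ e * h))   ≤⟨ *-monoˡ-≤ (0≤/ 4 (suc e)) (^-slope-≥ 0≤s s≤t e) ⟩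
    + 4 / suc e * (t ^ suc e - s ^ suc e)     ∎
    where open ℚ.≤-Reasoning

  arctan4-increment : ∀ n → ι 4 * h * (1ℚ + s ^ exponent n) ≤
    (1ℚ + s * s) * (arctan4 n t - arctan4 n s) + ι (curvature n) * (h * h)
  arctan4-increment zero = ℚ.≤-reflexive (trans (base (ι 4) s t)
    (cong (λ z → (1ℚ + s * s) * (ι 4 * t - ι 4 * s) + z * (h * h)) (sym ι-0)))
    where
    base : ∀ f s t → f * (t - s) * (1ℚ + s * (s * 1ℚ)) ≡ (1ℚ + s * s) * (f * t - f * s) + 0ℚ * ((t - s) * (t - s))
    base = RingSolver.solve-∀ ℚ-ring
  -- The difference of the two sides is displayed as a sum of nonnegative terms: the induction
  -- hypothesis, the slope estimates for the two new monomials, the Lipschitz bound for t^e - s^e,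
  -- and s² ≤ 1. Since (1 + s²) (s^(e+2) - s^e) = s^(e+4) - s^e, the remainder passes from s^e to
  -- s^(e+4).
  arctan4-increment (suc n) = +-excess
    (0≤-+ (0≤-+ (p≤q⇒0≤q-p (arctan4-increment n))
      (0≤-* 0≤1+s² (0≤-+ (p≤q⇒0≤q-p (term-≤ e)) (p≤q⇒0≤q-p (term-≥ (2 ℕ.+ e))))))
      (0≤-* (0≤-* (0≤ι 4) 0≤h) (0≤-+ (0≤-* 0≤1+s² (p≤q⇒0≤q-p (^-lipschitz 0≤s s≤t t≤1 e)))
        (0≤-* (0≤-* (0≤ι e) 0≤h) (p≤q⇒0≤q-p s²≤1)))))
    (trans (step (ι 4) s h (s ^ e) (t ^ e) (arctan4 n s) (arctan4 n t) (ι (curvature n)) (ι e)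
                  (+ 4 / suc e) (t ^ suc e) (s ^ suc e) (+ 4 / suc (2 ℕ.+ e)) (t ^ suc (2 ℕ.+ e)) (s ^ suc (2 ℕ.+ e)))
      (cong (λ z → (1ℚ + s * s) * (arctan4 (suc n) t - arctan4 (suc n) s) + z * (h * h)) (sym curvature-suc)))
    where
    e = exponent n
    curvature-suc : ι (curvature (suc n)) ≡ ι (curvature n) + (ι 4 * ι e + ι 4 * ι e)
    curvature-suc = trans (ι-+ (curvature n) _) (cong (λ z → ι (curvature n) + z)
      (trans (ι-+ (4 ℕ.* e) (4 ℕ.* e)) (cong₂ _+_ (ι-* 4 e) (ι-* 4 e))))
    step : ∀ f s h S T a b c ε q₁ T₁ S₁ q₃ T₃ S₃ →
      f * h * (1ℚ + s * (s * (s * (s * S)))) +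
        ((1ℚ + s * s) * (b - a) + c * (h * h) - f * h * (1ℚ + S)
          + (1ℚ + s * s) * (f * (T * h) - q₁ * (T₁ - S₁) + (q₃ * (T₃ - S₃) - f * (s * (s * S) * h)))
          + f * h * ((1ℚ + s * s) * (ε * h - (T - S)) + ε * h * (1ℚ - s * s)))
      ≡ (1ℚ + s * s) * (b - q₁ * T₁ + q₃ * T₃ - (a - q₁ * S₁ + q₃ * S₃)) + (c + (f * ε + f * ε)) * (h * h)
    step = RingSolver.solve-∀ ℚ-ring

  -- Dropping the nonnegative remainder s ^ `exponent n` is what lets each odd partial sum serve as
  -- an upper bound, with no limit in `n`.
  arctan4-slope : ∀ n → ι 4 * h ≤
    (1ℚ + s * s) * (arctan4 n t - arctan4 n s + ι (curvature n) * (h * h))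
  arctan4-slope n = ℚ.≤-trans
    (+-excess (0≤-* (0≤-* (0≤ι 4) 0≤h) (0≤^ 0≤s (exponent n))) (unfold (ι 4 * h) (s ^ exponent n)))
    (ℚ.≤-trans (arctan4-increment n)
      (+-excess (0≤-* (0≤-* 0≤s 0≤s) (0≤-* (0≤ι (curvature n)) (0≤-* 0≤h 0≤h)))
        (collect s (arctan4 n t - arctan4 n s) (ι (curvature n) * (h * h)))))
    where
    unfold : ∀ a S → a + a * S ≡ a * (1ℚ + S)
    unfold = RingSolver.solve-∀ ℚ-ring
    collect : ∀ s a b → (1ℚ + s * s) * a + b + s * s * b ≡ (1ℚ + s * s) * (a + b)
    collect = RingSolver.solve-∀ ℚ-ring

-- Riemann sums and the limit in the number of sectors

positive-multiple : ∀ {d} → 0ℚ < d → ∃ λ n → NonZero n × 1ℚ ≤ ι n * d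
positive-multiple {d@(mkℚ (+ suc m) n-1 _)} _ = suc n-1 , _ , (begin
  1ℚ                              ≡⟨ ι-1 ⟨
  ι 1                             ≤⟨ ι-mono-≤ (s≤s (z≤n {m})) ⟩
  ι (suc m)                       ≡⟨ ι-/-* (suc m) (suc n-1) ⟨
  + suc m / suc n-1 * ι (suc n-1) ≡⟨ cong (_* ι (suc n-1)) (ℚ.↥p/↧p≡p d) ⟩
  d * ι (suc n-1)                 ≡⟨ ℚ.*-comm d (ι (suc n-1)) ⟩
  ι (suc n-1) * d                 ∎)
  where open ℚ.≤-Reasoning
positive-multiple {mkℚ (+ zero) n-1 _} (ℚ.*<* (ℤ.+<+ ()))
positive-multiple {mkℚ -[1+ _ ] n-1 _} (ℚ.*<* ())

archimedean : ∀ {x y} c → (∀ n .{{_ : NonZero n}} → ι n * x ≤ ι n * y + ι c) → x ≤ y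
archimedean {x} {y} c h = ℚ.≮⇒≥ λ y<x →
  let 0<d = subst (_< x - y) (ℚ.+-inverseʳ y) (ℚ.+-monoˡ-< (- y) y<x)
      n , n≢0 , 1≤nd = positive-multiple 0<d
      -- This multiple makes k (x - y) at least c + 1, whereas the hypothesis allows at most c.
      k = suc c ℕ.* n
      k≢0 = ℕ.m*n≢0 (suc c) n {{_}} {{n≢0}}
  in ⊥-elim (ℕ.1+n≰n {c} (ι-cancel-≤ (begin
    ι (suc c)                   ≡⟨ ℚ.*-identityʳ (ι (suc c)) ⟨
    ι (suc c) * 1ℚ              ≤⟨ *-monoˡ-≤ (0≤ι (suc c)) 1≤nd ⟩
    ι (suc c) * (ι n * (x - y)) ≡⟨ ℚ.*-assoc (ι (suc c)) (ι n) (x - y) ⟨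
    ι (suc c) * ι n * (x - y)   ≡⟨ cong (_* (x - y)) (ι-* (suc c) n) ⟨
    ι k * (x - y)               ≡⟨ distrib (ι k) x y ⟩
    ι k * x - ι k * y           ≤⟨ ℚ.+-monoˡ-≤ (- (ι k * y)) (h k {{k≢0}}) ⟩
    ι k * y + ι c - ι k * y     ≡⟨ cancel (ι k * y) (ι c) ⟩
    ι c                         ∎)))
  where
  open ℚ.≤-Reasoning
  distrib : ∀ k x y → k * (x - y) ≡ k * x - k * y
  distrib = RingSolver.solve-∀ ℚ-ring
  cancel : ∀ a c → a + c - a ≡ c
  cancel = RingSolver.solve-∀ ℚ-ring

module _ (M K : ℕ) .{{_ : NonZero K}} (n : ℕ) where
  open Sectors M K

  private
    h = + 1 / K
    c = ι (curvature n)
    M² = ι (M ℕ.* M)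

    0≤h′ : 0ℚ ≤ h
    0≤h′ = 0≤/ 1 K

    Kh≡1 : ι K * h ≡ 1ℚ
    Kh≡1 = trans (ℚ.*-comm (ι K) h) (trans (ι-/-* 1 K) ι-1)

  node : ℕ → ℚ
  node k = ι k * h

  node-step : ∀ k → node (suc k) - node k ≡ h
  node-step k = trans (cong (λ z → z * h - node k) (ι-suc k)) (eq (ι k) h)
    where
    eq : ∀ k h → (1ℚ + k) * h - k * h ≡ h
    eq = RingSolver.solve-∀ ℚ-ring

  node-mono : ∀ {j k} → j ℕ.≤ k → node j ≤ node k
  node-mono j≤k = *-monoʳ-≤ 0≤h′ (ι-mono-≤ j≤k)

  reach-≤ : ∀ k → ι (reach k ℕ.* reach k) * (1ℚ + node k * node k) ≤ M²
  reach-≤ k = begin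
    x² * (1ℚ + node k * node k)
      ≡⟨ cong (λ z → x² * (z + node k * node k)) (trans (cong₂ _*_ Kh≡1 Kh≡1) (ℚ.*-identityˡ 1ℚ)) ⟨
    x² * (ι K * h * (ι K * h) + node k * node k)
      ≡⟨ factor x² (ι K) (ι k) h ⟩
    x² * (ι K * ι K + ι k * ι k) * (h * h)
      ≡⟨ cong (_* (h * h)) (trans (ι-* (reach k ℕ.* reach k) _) (cong (x² *_)
           (trans (ι-+ (K ℕ.* K) (k ℕ.* k)) (cong₂ _+_ (ι-* K K) (ι-* k k))))) ⟨
    ι (reach k ℕ.* reach k ℕ.* (K ℕ.* K ℕ.+ k ℕ.* k)) * (h * h)
      ≤⟨ *-monoʳ-≤ (0≤-* 0≤h′ 0≤h′) (ι-mono-≤ (reach-within k)) ⟩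
    ι (K ℕ.* K ℕ.* (M ℕ.* M)) * (h * h)
      ≡⟨ cong (_* (h * h)) (trans (ι-* (K ℕ.* K) (M ℕ.* M)) (cong (_* M²) (ι-* K K))) ⟩
    ι K * ι K * M² * (h * h)
      ≡⟨ regroup (ι K) M² h ⟩
    ι K * h * (ι K * h) * M²
      ≡⟨ cong (_* M²) (trans (cong₂ _*_ Kh≡1 Kh≡1) (ℚ.*-identityˡ 1ℚ)) ⟩
    1ℚ * M²  ≡⟨ ℚ.*-identityˡ M² ⟩
    M²       ∎
    where
    open ℚ.≤-Reasoning
    x² = ι (reach k ℕ.* reach k)
    factor : ∀ x K k h → x * (K * h * (K * h) + k * h * (k * h)) ≡ x * (K * K + k * k) * (h * h)
    factor = RingSolver.solve-∀ ℚ-ring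
    regroup : ∀ K M h → K * K * M * (h * h) ≡ K * h * (K * h) * M
    regroup = RingSolver.solve-∀ ℚ-ring

  -- Combines 4 h ≤ (1 + s²) Δ with (1 + s²) x² ≤ M², so the factor 1 + s² disappears without a
  -- division. Multiplying by Δ needs Δ ≥ 0, which the first inequality also yields.
  sector-area : ∀ {k} → k ℕ.< K → ι 4 * h * ι (reach k ℕ.* reach k) ≤
    M² * (arctan4 n (node (suc k)) - arctan4 n (node k) + c * (h * h))
  sector-area {k} k<K = begin
    ι 4 * h * x²             ≤⟨ *-monoʳ-≤ (0≤ι _) slope ⟩
    (1ℚ + s * s) * Δ * x²    ≡⟨ regroup (1ℚ + s * s) Δ x² ⟩
    x² * (1ℚ + s * s) * Δ    ≤⟨ *-monoʳ-≤ 0≤Δ (reach-≤ k) ⟩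
    M² * Δ                   ∎
    where
    open ℚ.≤-Reasoning
    s = node k
    x² = ι (reach k ℕ.* reach k)
    Δ = arctan4 n (node (suc k)) - arctan4 n s + c * (h * h)
    regroup : ∀ a b c → a * b * c ≡ c * a * b
    regroup = RingSolver.solve-∀ ℚ-ring
    0≤s : 0ℚ ≤ s
    0≤s = 0≤-* (0≤ι k) 0≤h′
    slope : ι 4 * h ≤ (1ℚ + s * s) * Δ
    slope = subst (λ z → ι 4 * z ≤ (1ℚ + s * s) * (arctan4 n (node (suc k)) - arctan4 n s + c * (z * z))) (node-step k)
      (arctan4-slope 0≤s (node-mono (ℕ.n≤1+n k)) (subst (node (suc k) ≤_) Kh≡1 (node-mono k<K)) n)
    0<1+s² : 0ℚ < 1ℚ + s * s
    0<1+s² = ℚ.<-≤-trans (ℚ.positive⁻¹ 1ℚ) (+-excess (0≤-* 0≤s 0≤s) refl)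
    0≤Δ : 0ℚ ≤ Δ
    0≤Δ = ℚ.*-cancelˡ-≤-pos (1ℚ + s * s) {{ℚ.positive 0<1+s²}}
      (subst (_≤ (1ℚ + s * s) * Δ) (sym (ℚ.*-zeroʳ (1ℚ + s * s))) (ℚ.≤-trans (0≤-* (0≤ι 4) 0≤h′) slope))

  sectors-area : ∀ j → j ℕ.≤ K → ι 4 * h * ι (sumTo j (λ k → reach k ℕ.* reach k)) ≤
    M² * (arctan4 n (node j) - arctan4 n (node 0) + ι j * (c * (h * h)))
  sectors-area zero _ = ℚ.≤-reflexive (begin-equality
    ι 4 * h * ι 0                           ≡⟨ cong (ι 4 * h *_) ι-0 ⟩
    ι 4 * h * 0ℚ                            ≡⟨ vanish (ι 4 * h) M² (arctan4 n (node 0)) (c * (h * h)) ⟩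
    M² * (a - a + 0ℚ * (c * (h * h)))       ≡⟨ cong (λ z → M² * (a - a + z * (c * (h * h)))) ι-0 ⟨
    M² * (a - a + ι 0 * (c * (h * h)))      ∎)
    where
    open ℚ.≤-Reasoning
    a = arctan4 n (node 0)
    vanish : ∀ f m a c → f * 0ℚ ≡ m * (a - a + 0ℚ * c)
    vanish = RingSolver.solve-∀ ℚ-ring
  sectors-area (suc j) j<K = begin
    ι 4 * h * ι (S ℕ.+ reach j ℕ.* reach j)         ≡⟨ cong (ι 4 * h *_) (ι-+ S (reach j ℕ.* reach j)) ⟩
    ι 4 * h * (ι S + ι (reach j ℕ.* reach j))       ≡⟨ ℚ.*-distribˡ-+ (ι 4 * h) (ι S) _ ⟩
    ι 4 * h * ι S + ι 4 * h * ι (reach j ℕ.* reach j)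
      ≤⟨ ℚ.+-mono-≤ (sectors-area j (ℕ.<⇒≤ j<K)) (sector-area j<K) ⟩
    M² * (arctan4 n (node j) - arctan4 n (node 0) + ι j * e) + M² * (arctan4 n (node (suc j)) - arctan4 n (node j) + e)
      ≡⟨ telescope M² (arctan4 n (node 0)) (arctan4 n (node j)) (arctan4 n (node (suc j))) (ι j) e ⟩
    M² * (arctan4 n (node (suc j)) - arctan4 n (node 0) + (1ℚ + ι j) * e)
      ≡⟨ cong (λ z → M² * (arctan4 n (node (suc j)) - arctan4 n (node 0) + z * e)) (ι-suc j) ⟨
    M² * (arctan4 n (node (suc j)) - arctan4 n (node 0) + ι (suc j) * e) ∎
    where
    open ℚ.≤-Reasoning
    S = sumTo j (λ k → reach k ℕ.* reach k)
    e = c * (h * h)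
    telescope : ∀ m a b d j e → m * (b - a + j * e) + m * (d - b + e) ≡ m * (d - a + (1ℚ + j) * e)
    telescope = RingSolver.solve-∀ ℚ-ring

  -- After multiplication by `K`, the local errors c h² add up to M² c (K h)² = M² c.
  sectors-total : ι 4 * ι (sumTo K (λ k → reach k ℕ.* reach k)) ≤ ι K * (M² * leibniz (suc (2 ℕ.* n))) + M² * c
  sectors-total = begin
    ι 4 * S                             ≡⟨ ℚ.*-identityˡ (ι 4 * S) ⟨
    1ℚ * (ι 4 * S)                      ≡⟨ cong (_* (ι 4 * S)) Kh≡1 ⟨
    ι K * h * (ι 4 * S)                 ≡⟨ regroup (ι K) h (ι 4) S ⟩
    ι K * (ι 4 * h * S)                 ≤⟨ *-monoˡ-≤ (0≤ι K) (sectors-area K ℕ.≤-refl) ⟩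
    ι K * (M² * (arctan4 n (node K) - arctan4 n (node 0) + ι K * (c * (h * h))))
      ≡⟨ cong₂ (λ x y → ι K * (M² * (x - y + ι K * (c * (h * h)))))
           (trans (cong (arctan4 n) Kh≡1) (arctan4-1 n))
           (trans (cong (arctan4 n) (trans (cong (_* h) ι-0) (ℚ.*-zeroˡ h))) (arctan4-0 n)) ⟩
    ι K * (M² * (leibniz (suc (2 ℕ.* n)) - 0ℚ + ι K * (c * (h * h))))
      ≡⟨ expand (ι K) M² (leibniz (suc (2 ℕ.* n))) c h ⟩
    ι K * (M² * leibniz (suc (2 ℕ.* n))) + M² * c * (ι K * h * (ι K * h))
      ≡⟨ cong (λ z → ι K * (M² * leibniz (suc (2 ℕ.* n))) + M² * c * (z * z)) Kh≡1 ⟩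
    ι K * (M² * leibniz (suc (2 ℕ.* n))) + M² * c * (1ℚ * 1ℚ)
      ≡⟨ cong (λ z → ι K * (M² * leibniz (suc (2 ℕ.* n))) + z) (ℚ.*-identityʳ (M² * c)) ⟩
    ι K * (M² * leibniz (suc (2 ℕ.* n))) + M² * c ∎
    where
    open ℚ.≤-Reasoning
    S = ι (sumTo K (λ k → reach k ℕ.* reach k))
    regroup : ∀ K h f S → K * h * (f * S) ≡ K * (f * h * S)
    regroup = RingSolver.solve-∀ ℚ-ring
    expand : ∀ K m l c h → K * (m * (l - 0ℚ + K * (c * (h * h)))) ≡ K * (m * l) + m * c * (K * h * (K * h))
    expand = RingSolver.solve-∀ ℚ-ring

  #cells-upper : ι (4 ℕ.* (K ℕ.* #cells M)) ≤
    ι K * (M² * leibniz (suc (2 ℕ.* n))) + ι (M ℕ.* M ℕ.* curvature n ℕ.+ 4 ℕ.* (K ℕ.* (5 ℕ.* K ℕ.* M)))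
  #cells-upper = begin
    ι (4 ℕ.* (K ℕ.* #cells M))                 ≤⟨ ι-mono-≤ (ℕ.*-monoʳ-≤ 4 #cells-sectors) ⟩
    ι (4 ℕ.* (S ℕ.+ E))                        ≡⟨ cong ι (ℕ.*-distribˡ-+ 4 S E) ⟩
    ι (4 ℕ.* S ℕ.+ 4 ℕ.* E)                    ≡⟨ trans (ι-+ (4 ℕ.* S) (4 ℕ.* E)) (cong (_+ ι (4 ℕ.* E)) (ι-* 4 S)) ⟩
    ι 4 * ι S + ι (4 ℕ.* E)                    ≤⟨ ℚ.+-monoˡ-≤ (ι (4 ℕ.* E)) sectors-total ⟩
    main + M² * c + ι (4 ℕ.* E)                ≡⟨ ℚ.+-assoc main (M² * c) _ ⟩
    main + (M² * c + ι (4 ℕ.* E))              ≡⟨ cong (λ z → main + (z + ι (4 ℕ.* E))) (ι-* (M ℕ.* M) (curvature n)) ⟨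
    main + (ι (M ℕ.* M ℕ.* curvature n) + ι (4 ℕ.* E)) ≡⟨ cong (λ z → main + z) (ι-+ (M ℕ.* M ℕ.* curvature n) (4 ℕ.* E)) ⟨
    main + ι (M ℕ.* M ℕ.* curvature n ℕ.+ 4 ℕ.* E) ∎
    where
    open ℚ.≤-Reasoning
    S = sumTo K (λ k → reach k ℕ.* reach k)
    E = K ℕ.* (5 ℕ.* K ℕ.* M)
    main = ι K * (M² * leibniz (suc (2 ℕ.* n)))

-- The estimate for M = D K² and K sectors has relative error O(1/K).
#cells≤leibniz : ∀ D n → ι (4 ℕ.* #cells D) ≤ ι (D ℕ.* D) * leibniz (suc (2 ℕ.* n))
#cells≤leibniz D n = archimedean (D ℕ.* D ℕ.* curvature n ℕ.+ 20 ℕ.* D) scaled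
  where
  ℓ = leibniz (suc (2 ℕ.* n))
  scaled : ∀ K .{{_ : NonZero K}} → ι K * ι (4 ℕ.* #cells D) ≤
    ι K * (ι (D ℕ.* D) * ℓ) + ι (D ℕ.* D ℕ.* curvature n ℕ.+ 20 ℕ.* D)
  scaled K = ℚ.*-cancelˡ-≤-pos (ι (R ℕ.* R)) {{ℚ.positive 0<R²}} (begin
    ι (R ℕ.* R) * (ι K * ι (4 ℕ.* #cells D))
      ≡⟨ trans (cong (ι (R ℕ.* R) *_) (sym (ι-* K (4 ℕ.* #cells D)))) (sym (ι-* (R ℕ.* R) _)) ⟩
    ι (R ℕ.* R ℕ.* (K ℕ.* (4 ℕ.* #cells D)))
      ≡⟨ cong ι (regroup (R ℕ.* R) K (#cells D)) ⟩
    ι (4 ℕ.* (K ℕ.* (R ℕ.* R ℕ.* #cells D)))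
      ≤⟨ ι-mono-≤ (ℕ.*-monoʳ-≤ 4 (ℕ.*-monoʳ-≤ K (#cells-scale D R))) ⟩
    ι (4 ℕ.* (K ℕ.* #cells (D ℕ.* R)))
      ≤⟨ #cells-upper (D ℕ.* R) K n ⟩
    ι K * (ι (D ℕ.* R ℕ.* (D ℕ.* R)) * ℓ) + ι (D ℕ.* R ℕ.* (D ℕ.* R) ℕ.* curvature n ℕ.+ 4 ℕ.* (K ℕ.* (5 ℕ.* K ℕ.* (D ℕ.* R))))
      ≡⟨ cong₂ (λ x y → ι K * (x * ℓ) + y)
           (trans (cong ι (leading D R)) (ι-* (R ℕ.* R) (D ℕ.* D)))
           (trans (cong ι (error D K (curvature n))) (ι-* (R ℕ.* R) _)) ⟩
    ι K * (ι (R ℕ.* R) * ι (D ℕ.* D) * ℓ) + ι (R ℕ.* R) * ι E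
      ≡⟨ factor (ι K) (ι (R ℕ.* R)) (ι (D ℕ.* D)) ℓ (ι E) ⟩
    ι (R ℕ.* R) * (ι K * (ι (D ℕ.* D) * ℓ) + ι E) ∎)
    where
    open ℚ.≤-Reasoning
    -- With this choice the rounding error 20 K² D R equals 20 D R², of the same form as the
    -- curvature error; dividing by R² leaves a bound free of `K`, as `archimedean` requires.
    R = K ℕ.* K
    E = D ℕ.* D ℕ.* curvature n ℕ.+ 20 ℕ.* D
    0<R² : 0ℚ < ι (R ℕ.* R)
    0<R² = ℚ.<-≤-trans (ℚ.positive⁻¹ 1ℚ) (subst (_≤ ι (R ℕ.* R)) ι-1
      (ι-mono-≤ (ℕ.>-nonZero⁻¹ (R ℕ.* R) {{ℕ.m*n≢0 R R {{ℕ.m*n≢0 K K}} {{ℕ.m*n≢0 K K}}}})))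
    regroup : ∀ r k q → r ℕ.* (k ℕ.* (4 ℕ.* q)) ≡ 4 ℕ.* (k ℕ.* (r ℕ.* q))
    regroup = solve-∀
    leading : ∀ D R → D ℕ.* R ℕ.* (D ℕ.* R) ≡ R ℕ.* R ℕ.* (D ℕ.* D)
    leading = solve-∀
    error : ∀ D K c → D ℕ.* (K ℕ.* K) ℕ.* (D ℕ.* (K ℕ.* K)) ℕ.* c ℕ.+ 4 ℕ.* (K ℕ.* (5 ℕ.* K ℕ.* (D ℕ.* (K ℕ.* K))))
      ≡ K ℕ.* K ℕ.* (K ℕ.* K) ℕ.* (D ℕ.* D ℕ.* c ℕ.+ 20 ℕ.* D)
    error = solve-∀
    factor : ∀ k r d l e → k * (r * d * l) + r * e ≡ r * (k * (d * l) + e)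
    factor = RingSolver.solve-∀ ℚ-ring

-- Comparison of roots and the final bound

module _ {x y : ℚ} (0≤y : 0ℚ ≤ y) where

  private
    *-mono-< : y < x → ∀ {p q} → 0ℚ < q → p ≤ q → y * p < x * q
    *-mono-< y<x {q = q} 0<q p≤q = ℚ.≤-<-trans (*-monoˡ-≤ 0≤y p≤q) (ℚ.*-monoˡ-<-pos q {{ℚ.positive 0<q}} y<x)

    0<x² : y < x → 0ℚ < x * x
    0<x² y<x = subst (_< x * x) (ℚ.*-zeroʳ y) (*-mono-< y<x (ℚ.≤-<-trans 0≤y y<x) (ℚ.≤-trans 0≤y (ℚ.<⇒≤ y<x)))

  √-mono : x * x ≤ y * y → x ≤ y
  √-mono h = ℚ.≮⇒≥ λ y<x → ℚ.<-irrefl refl (ℚ.<-≤-trans (*-mono-< y<x (ℚ.≤-<-trans 0≤y y<x) (ℚ.<⇒≤ y<x)) h)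

  ∛-mono : x * (x * x) ≤ y * (y * y) → x ≤ y
  ∛-mono h = ℚ.≮⇒≥ λ y<x → ℚ.<-irrefl refl (ℚ.<-≤-trans (*-mono-< y<x (0<x² y<x)
    (*-mono-≤ 0≤y (ℚ.<⇒≤ y<x) 0≤y (ℚ.<⇒≤ y<x))) h)

#cells≤π : ∀ {p} r → p >π → ι (4 ℕ.* #cells r) ≤ ι (r ℕ.* r) * p
#cells≤π r (n , leibniz<p) = ℚ.≤-trans (#cells≤leibniz r n) (*-monoˡ-≤ (0≤ι (r ℕ.* r)) (ℚ.<⇒≤ leibniz<p))

-- The rationals `a`, `b`, `u` range over upper bounds of √π / 2, of 3 π^(1/3) / 2^(5/3), whose cube
-- is 27 π / 32, and of r^(1/3). As `C` is chosen before them, letting them decrease to these values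
-- gives the inequality between real numbers.
theorem8 : ∃ λ (C : ℕ) → ∀ (r m : ℕ) → 1 ℕ.≤ r → DD m r →
    ∀ (a b u : ℚ) → 0ℚ ≤ a → 0ℚ ≤ b → 0ℚ ≤ u →
    (ℕtoℚ 4 * (a * a)) >π →
    ((ℕtoℚ 32 * (b * (b * b))) ℚ.÷ ℕtoℚ 27) >π →
    ℕtoℚ r ≤ u * (u * u) →
    ℕtoℚ m ≤ a * ℕtoℚ r + b * (u * u) + ℕtoℚ C * u
theorem8 = C , bound
  where
  -- 43 is half of 86; the additive constant `smallBound` is absorbed into the last term because u ≥
  -- 1.
  C : ℕ
  C = 43 ℕ.+ smallBound

  bound : ∀ (r m : ℕ) → 1 ℕ.≤ r → DD m r →
    ∀ (a b u : ℚ) → 0ℚ ≤ a → 0ℚ ≤ b → 0ℚ ≤ u →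
    (ℕtoℚ 4 * (a * a)) >π →
    ((ℕtoℚ 32 * (b * (b * b))) ℚ.÷ ℕtoℚ 27) >π →
    ℕtoℚ r ≤ u * (u * u) →
    ℕtoℚ m ≤ a * ℕtoℚ r + b * (u * u) + ℕtoℚ C * u
  bound r m 1≤r dd a b u 0≤a 0≤b 0≤u a>π b>π ℕr≤u³
    with A , w , A²≤q , w⁶≤q , 2m≤ ← dots-bound {{ℕ.>-nonZero 1≤r}} dd =
    subst₂ _≤_ (ι≡ℕtoℚ m) (cong₂ (λ x y → a * x + b * (u * u) + y * u) (ι≡ℕtoℚ r) (ι≡ℕtoℚ C))
      (ℚ.*-cancelˡ-≤-pos (ι 2) {{ℚ.positive 0<2}} (begin
        ι 2 * ι m
          ≡⟨ ι-* 2 m ⟨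
        ι (2 ℕ.* m)
          ≤⟨ ι-mono-≤ 2m≤ ⟩
        ι (2 ℕ.* A ℕ.+ 3 ℕ.* (w ℕ.* w) ℕ.+ 86 ℕ.* w ℕ.+ 2 ℕ.* smallBound)
          ≡⟨ trans (ι-+ (2 ℕ.* A ℕ.+ 3 ℕ.* (w ℕ.* w) ℕ.+ 86 ℕ.* w) _) (cong₂ _+_
               (trans (ι-+ (2 ℕ.* A ℕ.+ 3 ℕ.* (w ℕ.* w)) _) (cong₂ _+_
                 (trans (ι-+ (2 ℕ.* A) _) (cong (_+ ι (3 ℕ.* (w ℕ.* w))) (ι-* 2 A)))
                 (ι-* 86 w)))
               (ι-* 2 smallBound)) ⟩
        ι 2 * ι A + ι (3 ℕ.* (w ℕ.* w)) + ι 86 * ι w + ι 2 * ι smallBound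
          ≤⟨ ℚ.+-mono-≤ (ℚ.+-mono-≤ (ℚ.+-mono-≤ (*-monoˡ-≤ (0≤ι 2) A≤ar) 3w²≤2bu²) (*-monoˡ-≤ (0≤ι 86) w≤u))
               (*-monoˡ-≤ (0≤ι 2) (subst (_≤ ι smallBound * u) (ℚ.*-identityʳ _) (*-monoˡ-≤ (0≤ι smallBound) 1≤u))) ⟩
        ι 2 * (a * ι r) + ι 2 * (b * (u * u)) + ι 86 * u + ι 2 * (ι smallBound * u)
          ≡⟨ cong (λ z → ι 2 * (a * ι r) + ι 2 * (b * (u * u)) + z * u + ι 2 * (ι smallBound * u)) (ι-* 2 43) ⟩
        ι 2 * (a * ι r) + ι 2 * (b * (u * u)) + ι 2 * ι 43 * u + ι 2 * (ι smallBound * u)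
          ≡⟨ collect (ι 2) (a * ι r) (b * (u * u)) (ι 43) (ι smallBound) u ⟩
        ι 2 * (a * ι r + b * (u * u) + (ι 43 + ι smallBound) * u)
          ≡⟨ cong (λ z → ι 2 * (a * ι r + b * (u * u) + z * u)) (ι-+ 43 smallBound) ⟨
        ι 2 * (a * ι r + b * (u * u) + ι C * u) ∎))
    where
    open ℚ.≤-Reasoning
    q = #cells r

    0<ι : ∀ n → 0ℚ < ι (suc n)
    0<ι n = ℚ.<-≤-trans (ℚ.positive⁻¹ 1ℚ) (subst (_≤ ι (suc n)) ι-1 (ι-mono-≤ (s≤s (z≤n {n}))))

    0<2 : 0ℚ < ι 2
    0<2 = 0<ι 1

    collect : ∀ t x y c s u → t * x + t * y + t * c * u + t * (s * u) ≡ t * (x + y + (c + s) * u)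
    collect = RingSolver.solve-∀ ℚ-ring

    r≤u³ : ι r ≤ u * (u * u)
    r≤u³ = subst (_≤ u * (u * u)) (sym (ι≡ℕtoℚ r)) ℕr≤u³

    ι-cube : ∀ n → ι (cube n) ≡ ι n * (ι n * ι n)
    ι-cube n = trans (ι-* (n ℕ.* n) n) (trans (cong (_* ι n) (ι-* n n)) (ℚ.*-comm _ (ι n)))

    1≤u : 1ℚ ≤ u
    1≤u = ∛-mono 0≤u (ℚ.≤-trans (subst (_≤ ι r) ι-1 (ι-mono-≤ 1≤r)) r≤u³)

    w≤u : ι w ≤ u
    w≤u = ∛-mono 0≤u (begin
      ι w * (ι w * ι w)  ≡⟨ ι-cube w ⟨
      ι (cube w)         ≤⟨ ι-mono-≤ (²-cancel-≤ (ℕ.≤-trans w⁶≤q (#cells≤² r))) ⟩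
      ι r                ≤⟨ r≤u³ ⟩
      u * (u * u)        ∎)

    A≤ar : ι A ≤ a * ι r
    A≤ar = √-mono (0≤-* 0≤a (0≤ι r)) (ℚ.*-cancelˡ-≤-pos (ι 4) {{ℚ.positive (0<ι 3)}} (begin
      ι 4 * (ι A * ι A)              ≡⟨ trans (ι-* 4 (A ℕ.* A)) (cong (ι 4 *_) (ι-* A A)) ⟨
      ι (4 ℕ.* (A ℕ.* A))            ≤⟨ ι-mono-≤ (ℕ.*-monoʳ-≤ 4 A²≤q) ⟩
      ι (4 ℕ.* q)                    ≤⟨ #cells≤π r a>π ⟩
      ι (r ℕ.* r) * (ℕtoℚ 4 * (a * a)) ≡⟨ cong₂ (λ x y → x * (y * (a * a))) (ι-* r r) (sym (ι≡ℕtoℚ 4)) ⟩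
      ι r * ι r * (ι 4 * (a * a))    ≡⟨ regroup (ι r) (ι 4) a ⟩
      ι 4 * (a * ι r * (a * ι r))    ∎))
      where
      regroup : ∀ r f a → r * r * (f * (a * a)) ≡ f * (a * r * (a * r))
      regroup = RingSolver.solve-∀ ℚ-ring

    -- Cubes are compared: 4 (3 w²)³ = 27 · 4 w⁶ ≤ 27 · 4 q ≤ 32 b³ r², where 32 = 4 · 2³ and r² ≤
    -- u⁶.
    3w²≤2bu² : ι (3 ℕ.* (w ℕ.* w)) ≤ ι 2 * (b * (u * u))
    3w²≤2bu² = ∛-mono (0≤-* (0≤ι 2) (0≤-* 0≤b (0≤-* 0≤u 0≤u))) (ℚ.*-cancelˡ-≤-pos (ι 4) {{ℚ.positive (0<ι 3)}} (begin
      ι 4 * (x * (x * x))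
        ≡⟨ cong (ι 4 *_) (ι-cube (3 ℕ.* (w ℕ.* w))) ⟨
      ι 4 * ι (cube (3 ℕ.* (w ℕ.* w)))
        ≡⟨ ι-* 4 _ ⟨
      ι (4 ℕ.* cube (3 ℕ.* (w ℕ.* w)))
        ≡⟨ cong ι (regroup-ℕ w) ⟩
      ι (27 ℕ.* (4 ℕ.* (cube w ℕ.* cube w)))
        ≤⟨ ι-mono-≤ (ℕ.*-monoʳ-≤ 27 (ℕ.*-monoʳ-≤ 4 w⁶≤q)) ⟩
      ι (27 ℕ.* (4 ℕ.* q))
        ≡⟨ ι-* 27 (4 ℕ.* q) ⟩
      ι 27 * ι (4 ℕ.* q)
        ≤⟨ *-monoˡ-≤ (0≤ι 27) (#cells≤π r b>π) ⟩
      ι 27 * (ι (r ℕ.* r) * (ℕtoℚ 32 * (b * (b * b)) ℚ.÷ ℕtoℚ 27))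
        ≡⟨ cong₂ (λ y z → y * (z * (ℕtoℚ 32 * (b * (b * b)) ℚ.÷ ℕtoℚ 27))) (ι≡ℕtoℚ 27) (ι-* r r) ⟩
      ℕtoℚ 27 * (ι r * ι r * (ℕtoℚ 32 * (b * (b * b)) * ℚ.1/ ℕtoℚ 27))
        ≡⟨ cancel (ℕtoℚ 27) (ι r) (ℕtoℚ 32) b (ℚ.1/ ℕtoℚ 27) ⟩
      ℕtoℚ 27 * ℚ.1/ ℕtoℚ 27 * (ℕtoℚ 32 * (b * (b * b)) * (ι r * ι r))
        ≡⟨ cong₂ (λ y z → y * (z * (b * (b * b)) * (ι r * ι r))) (ℚ.*-inverseʳ (ℕtoℚ 27)) (trans (sym (ι≡ℕtoℚ 32))
             (trans (ι-* 4 8) (cong (ι 4 *_) (ι-cube 2)))) ⟩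
      1ℚ * (ι 4 * (ι 2 * (ι 2 * ι 2)) * (b * (b * b)) * (ι r * ι r))
        ≡⟨ ℚ.*-identityˡ _ ⟩
      ι 4 * (ι 2 * (ι 2 * ι 2)) * (b * (b * b)) * (ι r * ι r)
        ≤⟨ *-monoˡ-≤ (0≤-* (0≤-* (0≤ι 4) (0≤-* (0≤ι 2) (0≤-* (0≤ι 2) (0≤ι 2)))) (0≤-* 0≤b (0≤-* 0≤b 0≤b)))
             (*-mono-≤ (0≤ι r) r≤u³ (0≤ι r) r≤u³) ⟩
      ι 4 * (ι 2 * (ι 2 * ι 2)) * (b * (b * b)) * (u * (u * u) * (u * (u * u)))
        ≡⟨ regroup (ι 4) (ι 2) b u ⟩
      ι 4 * (y * (y * y)) ∎))
      where
      x = ι (3 ℕ.* (w ℕ.* w))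
      y = ι 2 * (b * (u * u))
      regroup-ℕ : ∀ w → 4 ℕ.* (3 ℕ.* (w ℕ.* w) ℕ.* (3 ℕ.* (w ℕ.* w)) ℕ.* (3 ℕ.* (w ℕ.* w))) ≡
        27 ℕ.* (4 ℕ.* (w ℕ.* w ℕ.* w ℕ.* (w ℕ.* w ℕ.* w)))
      regroup-ℕ = solve-∀
      cancel : ∀ n r f b i → n * (r * r * (f * (b * (b * b)) * i)) ≡ n * i * (f * (b * (b * b)) * (r * r))
      cancel = RingSolver.solve-∀ ℚ-ring
      regroup : ∀ f t b u → f * (t * (t * t)) * (b * (b * b)) * (u * (u * u) * (u * (u * u))) ≡
        f * (t * (b * (u * u)) * (t * (b * (u * u)) * (t * (b * (u * u)))))
      regroup = RingSolver.solve-∀ ℚ-ring
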